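{- Let $n\ge 2$. There is a constant $c_n$ depending only on $n$ such that for all finite collections $\mathfrak{L}_1,\ldots,\mathfrak{L}_n$ of $L_1,\ldots,L_n$ lines in $\mathbb{R}^n$, respectively, $$|J(\mathfrak{L}_1,\ldots,\mathfrak{L}_n)|\le c_n\,(L_1\cdots L_n)^{1/(n-1)}.$$
   Context: For finite collections $\mathfrak{L}_1,\ldots,\mathfrak{L}_n$ of lines in $\mathbb{R}^n$, a point $x\in\mathbb{R}^n$ is a multijoint formed by them if for each $i=1,\ldots,n$ there is a line $l_i\in\mathfrak{L}_i$ passing through $x$ such that the directions of $l_1,\ldots,l_n$ span $\mathbb{R}^n$. $J(\mathfrak{L}_1,\ldots,\mathfrak{L}_n)$ denotes the set of such multijoints. -}

module Defs where

open import Level using (0ℓ)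
open import Data.Nat using (ℕ; suc)
open import Data.Fin using (Fin; zero; suc)
open import Data.Product using (Σ; ∃; _×_; _,_)
open import Data.List using (List)
open import Data.Sum using (_⊎_)
open import Data.List.Membership.Propositional using (_∈_)
open import Relation.Binary.PropositionalEquality using (_≡_)
open import Relation.Nullary using (¬_)
open import Algebra.Structures using (IsCommutativeRing)

record RealNumbers : Set₁ where
  infixl 6 _+_
  infixl 7 _*_
  infix 4 _<_ _≤_
  field
    ℝ   : Set
    _+_ _*_ : ℝ → ℝ → ℝ
    -_  : ℝ → ℝ
    0ℝ 1ℝ : ℝ
    isCommutativeRing : IsCommutativeRing _≡_ _+_ _*_ -_ 0ℝ 1ℝ
    0≢1 : ¬ (0ℝ ≡ 1ℝ)
    inverse : ∀ x → ¬ (x ≡ 0ℝ) → Σ ℝ λ y → x * y ≡ 1ℝ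
    _<_ : ℝ → ℝ → Set
    <-irrefl : ∀ x → ¬ (x < x)
    <-trans : ∀ {x y z} → x < y → y < z → x < z
    <-trichotomy : ∀ x y → (x < y) ⊎ ((x ≡ y) ⊎ (y < x))
    +-mono-< : ∀ {x y} z → x < y → x + z < y + z
    *-pos : ∀ {x y} → 0ℝ < x → 0ℝ < y → 0ℝ < x * y
  _≤_ : ℝ → ℝ → Set
  x ≤ y = (x < y) ⊎ (x ≡ y)
  field
    lub : (S : ℝ → Set) → Σ ℝ S → Σ ℝ (λ b → ∀ x → S x → x ≤ b) →
          Σ ℝ λ s → (∀ x → S x → x ≤ s) × (∀ b → (∀ x → S x → x ≤ b) → s ≤ b)

module Geometry (R : RealNumbers) where
  open RealNumbers R

  Vec : ℕ → Set
  Vec n = Fin n → ℝ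

  ∑ : ∀ {n} → (Fin n → ℝ) → ℝ
  ∑ {ℕ.zero} f = 0ℝ
  ∑ {suc n} f = f zero + ∑ (λ i → f (suc i))

  record Line (n : ℕ) : Set where
    constructor line
    field
      base : Vec n
      dir  : Vec n
      dir≢0 : ¬ (∀ k → dir k ≡ 0ℝ)
  open Line public

  _∈ᴸ_ : ∀ {n} → Vec n → Line n → Set
  x ∈ᴸ l = Σ ℝ λ t → ∀ k → x k ≡ base l k + t * dir l k

  Spans : ∀ {n} → (Fin n → Vec n) → Set
  Spans {n} v = (w : Vec n) → Σ (Fin n → ℝ) λ a → ∀ k → w k ≡ ∑ (λ i → a i * v i k)

  IsMultijoint : ∀ {n} → (Fin n → List (Line n)) → Vec n → Set
  IsMultijoint {n} 𝔏 x =
    Σ ((i : Fin n) → Line n) λ l →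
      (∀ i → l i ∈ 𝔏 i) × (∀ i → x ∈ᴸ l i) × Spans (λ i → dir (l i))

  _≢ᵖ_ : ∀ {n} → Vec n → Vec n → Set
  x ≢ᵖ y = ¬ (∀ k → x k ≡ y k)

{-# OPTIONS --safe #-}
module Submission where

-- Give every joint p a handicap β p and ask at time t that a polynomial F of degree < D vanish at p to order t ∸ β p.
-- The step to t + 1 concerns the derivatives of order t ∸ β p along the n lines through p.  One that is taken at least
-- b p i times along the i-th line vanishes for free, where b p i + β p is the level at which the orders on this line
-- add up to D.  So at most Σ_p ∏_i b p i linear conditions force F = 0, and this sum is at least the dimension N of
-- the space from which F is taken.
-- Raising the handicaps of joints with a large product equalises the products, up to rounding: then m ∏_i (b p i + 1) ≥ N
-- for each of the m joints p, whereas the b p i add up to about D on each line.  Some joint has all its b p i bounded by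
-- n times their averages, and comparing the two bounds at this joint proves the theorem.

open import Defs

-- Handicaps may drift far apart, so the conditions are never counted over all joints at once. Some
-- window of length `D` contains no handicap in its interior. If time stops at its upper end
-- `s + D`, the joints above the window impose nothing, while a joint below it has reached order
-- `D`, enough to force F = 0. Counting only below the window also means that every raised joint had
-- handicap at most `m * D`; this makes the balancing terminate. Exact equality of the products is
-- out of reach: a raise may shrink a `b p i` of the raised joint by one, and the `+ 1` in the
-- balanced products absorbs this loss. In dimension n the space is spanned by Lagrange polynomials
-- on a grid of side m, so N = m^n and D = n m + 1. As D / m is bounded in terms of n, the lower
-- bound N / m = m^(n-1) for a product meets an upper bound of a constant times L_1 ⋯ L_n. No
-- coefficients in several variables appear: a polynomial is the family of its directional
-- derivatives, and its restrictions to lines are known through division by X - τ, which is enough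
-- to count zeros.

module Handicaps where

  open import Data.Nat
  open import Data.Nat.Properties
  open import Data.Fin using (Fin; zero; suc; toℕ)
  import Data.Fin.Properties as Fin
  open import Data.Product using (∃; _×_; _,_; proj₁; proj₂)
  open import Data.Sum using (_⊎_; inj₁; inj₂)
  open import Data.Bool using (if_then_else_; true; false)
  open import Data.Vec.Functional using (updateAt; foldr)
  open import Data.Vec.Functional.Properties using (updateAt-updates; updateAt-minimal)
  open import Relation.Nullary.Decidable using (_⊎-dec_)
  open import Relation.Nullary.Reflects using (ofʸ; ofⁿ)
  open import Relation.Nullary using (¬_; Dec; yes; no; does; contradiction)
  open import Relation.Binary.PropositionalEquality hiding ([_])
  open import Function using (_∘_)
  open import Algebra.Properties.CommutativeMonoid.Sum +-0-commutativeMonoid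
    using (sum; sum-cong-≗; ∑-distrib-+; ∑-comm; sum-replicate-zero)
  open import Data.Nat.Tactic.RingSolver using (solve-∀)

  -- Finite sums, averages and integer thresholds

  ∏ : ∀ {n} → (Fin n → ℕ) → ℕ
  ∏ = foldr _*_ 1

  at : ∀ {n} → Fin n → Fin n → ℕ → ℕ
  at i j x = if does (i Fin.≟ j) then x else 0

  if-yes : ∀ {A : Set} (a? : Dec A) {x y : ℕ} → A → (if does a? then x else y) ≡ x
  if-yes (yes _) a = refl
  if-yes (no ¬a) a = contradiction a ¬a

  if-no : ∀ {A : Set} (a? : Dec A) {x y : ℕ} → ¬ A → (if does a? then x else y) ≡ y
  if-no (yes a) ¬a = contradiction a ¬a
  if-no (no _) ¬a = refl

  sum-mono : ∀ {n} {f g : Fin n → ℕ} → (∀ i → f i ≤ g i) → sum f ≤ sum g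
  sum-mono {zero} h = z≤n
  sum-mono {suc n} h = +-mono-≤ (h zero) (sum-mono (h ∘ suc))

  sum-const : ∀ n c → sum {n} (λ _ → c) ≡ n * c
  sum-const zero c = refl
  sum-const (suc n) c = cong (c +_) (sum-const n c)

  sum-*ˡ : ∀ {n} c (f : Fin n → ℕ) → sum (λ i → c * f i) ≡ c * sum f
  sum-*ˡ {zero} c f = sym (*-zeroʳ c)
  sum-*ˡ {suc n} c f = trans (cong (c * f zero +_) (sum-*ˡ c (f ∘ suc))) (sym (*-distribˡ-+ c (f zero) _))

  sum-*ʳ : ∀ {n} c (f : Fin n → ℕ) → sum (λ i → f i * c) ≡ sum f * c
  sum-*ʳ c f = trans (sum-cong-≗ (λ i → *-comm (f i) c)) (trans (sum-*ˡ c f) (*-comm c _))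

  term≤sum : ∀ {n} (f : Fin n → ℕ) i → f i ≤ sum f
  term≤sum f zero = m≤m+n _ _
  term≤sum f (suc i) = ≤-trans (term≤sum (f ∘ suc) i) (m≤n+m _ _)

  at-refl : ∀ {n} (i : Fin n) x → at i i x ≡ x
  at-refl i x = if-yes (i Fin.≟ i) refl

  at-mono : ∀ {n} (i j : Fin n) {x y} → x ≤ y → at i j x ≤ at i j y
  at-mono i j x≤y with i Fin.≟ j
  ... | yes _ = x≤y
  ... | no _ = z≤n

  at-suc : ∀ {n} (i j : Fin n) x → at (suc i) (suc j) x ≡ at i j x
  at-suc i j x with i Fin.≟ j
  ... | yes _ = refl
  ... | no _ = refl

  sum-at : ∀ {n} (i : Fin n) (g : Fin n → ℕ) → sum (λ j → at i j (g j)) ≡ g i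
  sum-at {suc n} zero g = trans (cong (g zero +_) (sum-replicate-zero n)) (+-identityʳ _)
  sum-at (suc i) g = trans (sum-cong-≗ (λ j → at-suc i j (g (suc j)))) (sum-at i (g ∘ suc))

  ∏-mono : ∀ {n} (f g : Fin n → ℕ) → (∀ i → f i ≤ g i) → ∏ f ≤ ∏ g
  ∏-mono {zero} f g h = ≤-refl
  ∏-mono {suc n} f g h = *-mono-≤ (h zero) (∏-mono (f ∘ suc) (g ∘ suc) (h ∘ suc))

  ∏-*ˡ : ∀ {n} c (f : Fin n → ℕ) → ∏ (λ i → c * f i) ≡ c ^ n * ∏ f
  ∏-*ˡ {zero} c f = refl
  ∏-*ˡ {suc n} c f = trans (cong (c * f zero *_) (∏-*ˡ c (f ∘ suc)))
    ([m*n]*[o*p]≡[m*o]*[n*p] c (f zero) (c ^ n) (∏ (f ∘ suc)))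

  max-average : ∀ {m} (f : Fin m → ℕ) N → 0 < N → N ≤ sum f → ∃ λ p → N ≤ m * f p
  max-average {m} f N 0<N N≤ with Fin.any? (λ p → N ≤? m * f p)
  ... | yes found = found
  ... | no none = contradiction (≤-trans (*-monoʳ-≤ m N≤) (≤-reflexive (sym (sum-*ˡ m f))))
                    (<⇒≱ (go {m} m f ne small))
    where
    small : ∀ p → m * f p < N
    small p = ≰⇒> λ le → none (p , le)
    ne : 0 < m
    ne = pos f N≤
      where
      pos : ∀ {k} (g : Fin k → ℕ) → N ≤ sum g → 0 < k
      pos {zero} g N≤0 = contradiction N≤0 (<⇒≱ 0<N)
      pos {suc k} g _ = z<s
    go : ∀ {c} k (g : Fin k → ℕ) → 0 < k → (∀ p → c * g p < N) → sum (λ p → c * g p) < k * N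
    go (suc zero) g _ h = subst₂ _<_ (sym (+-identityʳ _)) (sym (+-identityʳ N)) (h zero)
    go {c} (suc (suc k)) g _ h = +-mono-< (h zero) (go {c} (suc k) (g ∘ suc) z<s (h ∘ suc))

  -- By Markov's inequality fewer than m / n of the p are bad for a given i, so a union bound leaves a p that is good for every i.
  simultaneous-markov : ∀ {m n} → 0 < m → 0 < n → (x : Fin m → Fin n → ℕ) →
    ∃ λ p → ∀ i → m * x p i ≤ n * sum (λ q → x q i)
  simultaneous-markov {m} {n} 0<m 0<n x with Fin.any? (λ p → Fin.all? (λ i → m * x p i ≤? n * sum (λ q → x q i)))
  ... | yes found = found
  ... | no none = contradiction m≤bad (<⇒≱ bad<m)
    where
    S : Fin n → ℕ
    S i = sum (λ q → x q i)
    bad : Fin m → Fin n → ℕ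
    bad p i = if does (m * x p i ≤? n * S i) then 0 else 1
    bad-weight : ∀ p i → bad p i * suc (n * S i) ≤ m * x p i
    bad-weight p i = weigh (m * x p i ≤? n * S i)
      where
      weigh : (good? : Dec (m * x p i ≤ n * S i)) →
        (if does good? then 0 else 1) * suc (n * S i) ≤ m * x p i
      weigh (yes _) = z≤n
      weigh (no ≰) = ≤-trans (≤-reflexive (+-identityʳ _)) (≰⇒> ≰)
    count : Fin n → ℕ
    count i = sum (λ p → bad p i)
    count-weight : ∀ i → count i * suc (n * S i) ≤ m * S i
    count-weight i = ≤-trans (≤-reflexive (sym (sum-*ʳ _ (λ p → bad p i))))
      (≤-trans (sum-mono (λ p → bad-weight p i)) (≤-reflexive (sum-*ˡ m (λ q → x q i))))
    -- Being bad means exceeding the threshold by at least one. This unit makes the bound strict, so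
    -- that summing over the `n` indices leaves fewer than `m` bad pairs.
    count-small : ∀ c s → c * suc (n * s) ≤ m * s → suc (n * c) ≤ m
    count-small zero s _ = ≤-trans (≤-reflexive (cong suc (*-zeroʳ n))) 0<m
    count-small (suc c) s h = *-cancelʳ-< s (n * suc c) m
      (≤-trans (≤-trans (m≤m+n (suc (n * suc c * s)) c) (≤-reflexive (rearrange n c s))) h)
      where
      rearrange : ∀ n c s → suc (n * suc c * s) + c ≡ suc c * suc (n * s)
      rearrange = solve-∀
    bad<m : sum count < m
    bad<m = *-cancelˡ-< n (sum count) m
      (≤-trans (≤-trans (+-monoˡ-≤ (n * sum count) 0<n)
         (≤-reflexive (sym (sum-suc count))))
       (≤-trans (sum-mono (λ i → count-small (count i) (S i) (count-weight i))) (≤-reflexive (sum-const n m))))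
      where
      sum-suc : ∀ (f : Fin n → ℕ) → sum (λ i → suc (n * f i)) ≡ n + n * sum f
      sum-suc f = trans (∑-distrib-+ (λ _ → 1) (λ i → n * f i))
        (cong₂ _+_ (trans (sum-const n 1) (*-identityʳ n)) (sum-*ˡ n f))
    one-bad : ∀ p → 1 ≤ sum (bad p)
    one-bad p with Fin.¬∀⟶∃¬ n _ (λ i → m * x p i ≤? n * S i) (λ all → none (p , all))
    ... | i , ≰ = subst (_≤ sum (bad p)) (if-no (m * x p i ≤? n * S i) ≰) (term≤sum (bad p) i)
    m≤bad : m ≤ sum count
    m≤bad = begin
      m                              ≡⟨ *-identityʳ m ⟨
      m * 1                          ≡⟨ sum-const m 1 ⟨
      sum {m} (λ _ → 1)              ≤⟨ sum-mono one-bad ⟩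
      sum (λ p → sum (bad p))        ≡⟨ ∑-comm bad ⟩
      sum count                      ∎
      where open ≤-Reasoning

  raise : ∀ {m} → (Fin m → ℕ) → Fin m → Fin m → ℕ
  raise β q = updateAt β q suc

  sum-raise : ∀ {m} (β : Fin m → ℕ) q → sum (raise β q) ≡ suc (sum β)
  sum-raise β zero = refl
  sum-raise β (suc q) = trans (cong (β zero +_) (sum-raise (β ∘ suc) q)) (+-suc _ _)

  raise≤ : ∀ {m} (β : Fin m → ℕ) q {B} → (∀ p → β p ≤ B) → β q < B → ∀ p → raise β q p ≤ B
  raise≤ β zero β≤ βq< zero = βq<
  raise≤ β zero β≤ βq< (suc p) = β≤ (suc p)
  raise≤ β (suc q) β≤ βq< zero = β≤ zero
  raise≤ β (suc q) β≤ βq< (suc p) = raise≤ (β ∘ suc) q (β≤ ∘ suc) βq< p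

  ≤raise : ∀ {m} (β : Fin m → ℕ) q p → β p ≤ raise β q p
  ≤raise β zero zero = n≤1+n _
  ≤raise β zero (suc p) = ≤-refl
  ≤raise β (suc q) zero = ≤-refl
  ≤raise β (suc q) (suc p) = ≤raise (β ∘ suc) q p

  lower : ∀ {k} → (Fin k → ℕ) → Fin k → Fin k → ℕ
  lower μ i = updateAt μ i pred

  sum-lower : ∀ {k} (μ : Fin k → ℕ) i → 0 < μ i → sum μ ≡ suc (sum (lower μ i))
  sum-lower μ zero 0<μ with μ zero
  ... | suc _ = refl
  sum-lower μ (suc i) 0<μ = trans (cong (μ zero +_) (sum-lower (μ ∘ suc) i 0<μ)) (+-suc _ _)

  lower≤ : ∀ {k} (μ : Fin k → ℕ) i j → lower μ i j ≤ μ j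
  lower≤ μ zero zero = pred[n]≤n
  lower≤ μ zero (suc j) = ≤-refl
  lower≤ μ (suc i) zero = ≤-refl
  lower≤ μ (suc i) (suc j) = lower≤ (μ ∘ suc) i j

  sum-positive : ∀ {k} (μ : Fin k → ℕ) → 0 < sum μ → ∃ λ i → 0 < μ i
  sum-positive {suc k} μ 0<sum with μ zero in eq
  ... | suc _ = zero , subst (0 <_) (sym eq) z<s
  ... | zero with sum-positive (μ ∘ suc) 0<sum
  ...   | i , 0<μ = suc i , 0<μ

  -- One of the m + 1 disjoint open intervals (k D , (k + 1) D) contains no value of β.
  gap : ∀ {m} (β : Fin m → ℕ) D → ∃ λ s → s ≤ m * D × (∀ p → β p ≤ s ⊎ s + D ≤ β p)
  gap {m} β D with Fin.any? (λ k → Fin.all? (outside? k))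
    module Gap where
    Outside : Fin (suc m) → Fin m → Set
    Outside k p = β p ≤ toℕ k * D ⊎ toℕ k * D + D ≤ β p
    outside? : ∀ k p → Dec (Outside k p)
    outside? k p = (β p ≤? toℕ k * D) ⊎-dec (toℕ k * D + D ≤? β p)
  ... | yes (k , empty) = toℕ k * D , *-monoˡ-≤ D (Fin.toℕ≤pred[n] k) , empty
  ... | no none = contradiction j<k (disjoint j k pj≡pk)
    where
    open Gap β D
    inside : ∀ k → ∃ λ p → ¬ Outside k p
    inside k = Fin.¬∀⟶∃¬ m _ (outside? k) (λ all → none (k , all))
    disjoint : ∀ j k → proj₁ (inside j) ≡ proj₁ (inside k) → ¬ toℕ j < toℕ k
    disjoint j k eq j<k = proj₂ (inside k) (inj₁ (begin
      β (proj₁ (inside k))  ≡⟨ cong β eq ⟨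
      β (proj₁ (inside j))  ≤⟨ <⇒≤ (≰⇒> (λ le → proj₂ (inside j) (inj₂ le))) ⟩
      toℕ j * D + D         ≡⟨ +-comm _ D ⟩
      suc (toℕ j) * D       ≤⟨ *-monoˡ-≤ D j<k ⟩
      toℕ k * D             ∎))
      where open ≤-Reasoning
    collision = Fin.pigeonhole (n<1+n m) (proj₁ ∘ inside)
    j = proj₁ collision
    k = proj₁ (proj₂ collision)
    j<k = proj₁ (proj₂ (proj₂ collision))
    pj≡pk = proj₂ (proj₂ (proj₂ collision))

  ∸-suc≤ : ∀ h b → h ∸ b ≤ suc (h ∸ suc b)
  ∸-suc≤ zero zero = z≤n
  ∸-suc≤ zero (suc b) = z≤n
  ∸-suc≤ (suc h) zero = ≤-refl
  ∸-suc≤ (suc h) (suc b) = ∸-suc≤ h b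

  abstract

    -- Bounded search for the first `h` with `D ≤ S h`. The value `k` signals failure, hence the
    -- hypothesis of `level-reached`.
    level : ℕ → (ℕ → ℕ) → ℕ → ℕ
    level D S zero = 0
    level D S (suc k) = if D ≤ᵇ S 0 then 0 else suc (level D (S ∘ suc) k)

    <level : ∀ {D} S k {h} → h < level D S k → S h < D
    <level {D} S (suc k) {h} h< with D ≤ᵇ S 0 | ≤ᵇ-reflects-≤ D (S 0)
    <level S (suc k) {zero} h< | false | ofⁿ ≰ = ≰⇒> ≰
    <level S (suc k) {suc h} (s≤s h<) | false | ofⁿ ≰ = <level (S ∘ suc) k h<

    level≤ : ∀ {D} S k {h} → D ≤ S h → level D S k ≤ h
    level≤ S k D≤ = ≮⇒≥ λ h< → <⇒≱ (<level S k h<) D≤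

    level-reached : ∀ {D} S k → level D S k < k → D ≤ S (level D S k)
    level-reached {D} S (suc k) l<k with D ≤ᵇ S 0 | ≤ᵇ-reflects-≤ D (S 0)
    ... | true | ofʸ D≤ = D≤
    ... | false | ofⁿ _ = level-reached (S ∘ suc) k (s≤s⁻¹ l<k)

    level-antitone : ∀ {D} S S′ k → (∀ h → S′ h ≤ S h) → level D S k ≤ level D S′ k
    level-antitone S S′ zero _ = z≤n
    level-antitone {D} S S′ (suc k) S′≤S
      with D ≤ᵇ S 0 | ≤ᵇ-reflects-≤ D (S 0) | D ≤ᵇ S′ 0 | ≤ᵇ-reflects-≤ D (S′ 0)
    ... | true | _ | _ | _ = z≤n
    ... | false | ofⁿ ≰ | true | ofʸ D≤ = contradiction (≤-trans D≤ (S′≤S 0)) ≰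
    ... | false | _ | false | _ = s≤s (level-antitone (S ∘ suc) (S′ ∘ suc) k (S′≤S ∘ suc))

  -- Balancing the handicaps

  module Balance {m n} {L : Fin (suc n) → ℕ} (κ : Fin m → (i : Fin (suc n)) → Fin (L i)) (D N : ℕ) where

    -- The total order of vanishing demanded at time `h` on the line `l` of the `i`-th family.
    mass : (Fin m → ℕ) → (i : Fin (suc n)) → Fin (L i) → ℕ → ℕ
    mass β i l h = sum (λ p → at (κ p i) l (h ∸ β p))

    -- The interface to the algebra. The hypothesis on `b` concerns the joints at or below `s`;
    -- setting `b` to zero at the others removes them from the sum.
    Covering : Set
    Covering = (β : Fin m → ℕ) (s : ℕ) (b : Fin m → Fin (suc n) → ℕ) →
      (∀ p → β p ≤ s ⊎ s + D ≤ β p) → (∃ λ p → β p ≤ s) →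
      (∀ p → β p ≤ s → ∀ i → D ≤ mass β i (κ p i) (b p i + β p)) →
      N ≤ sum (λ p → ∏ (b p))

    mass-monoʳ : ∀ β i l {h k} → h ≤ k → mass β i l h ≤ mass β i l k
    mass-monoʳ β i l h≤k = sum-mono (λ p → at-mono (κ p i) l (∸-monoˡ-≤ (β p) h≤k))

    mass-antitone : ∀ {β γ} → (∀ p → β p ≤ γ p) → ∀ i l h → mass γ i l h ≤ mass β i l h
    mass-antitone β≤γ i l h = sum-mono (λ p → at-mono (κ p i) l (∸-monoʳ-≤ h (β≤γ p)))

    -- A joint of handicap at most `m * D` supplies the mass `D` on its own by time `m * D + D`, so
    -- the search succeeds on every line through such a joint.
    height : (Fin m → ℕ) → (i : Fin (suc n)) → Fin (L i) → ℕ
    height β i l = level D (mass β i l) (suc (m * D + D))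

    height-raise : ∀ β q i l → height β i l ≤ height (raise β q) i l
    height-raise β q i l = level-antitone _ _ _ (mass-antitone (≤raise β q) i l)

    width : (Fin m → ℕ) → Fin m → Fin (suc n) → ℕ
    width β p i = height β i (κ p i) ∸ β p

    mass-width : ∀ β p i → β p ≤ m * D → D ≤ mass β i (κ p i) (width β p i + β p)
    mass-width β p i β≤ = ≤-trans reached (mass-monoʳ β i (κ p i) (≤-trans (m≤n+m∸n _ (β p)) (≤-reflexive (+-comm (β p) _))))
      where
      own : D ≤ mass β i (κ p i) (β p + D)
      own = begin
        D                                          ≡⟨ m+n∸m≡n (β p) D ⟨
        β p + D ∸ β p                              ≡⟨ at-refl (κ p i) _ ⟨
        at (κ p i) (κ p i) (β p + D ∸ β p)         ≤⟨ term≤sum (λ q → at (κ q i) (κ p i) (β p + D ∸ β q)) p ⟩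
        mass β i (κ p i) (β p + D)                 ∎
        where open ≤-Reasoning
      reached : D ≤ mass β i (κ p i) (height β i (κ p i))
      reached = level-reached (mass β i (κ p i)) _ (s≤s (≤-trans (level≤ (mass β i (κ p i)) _ own) (+-monoˡ-≤ D β≤)))

    module _ (covering : Covering) (0<N : 0 < N) where

      -- Averages the count over the joints below a gap. A joint of handicap zero lies below
      -- whichever gap is found, so the count applies.
      overfull : ∀ β → (∃ λ p → β p ≡ 0) → ∃ λ q → β q ≤ m * D × N ≤ m * ∏ (width β q)
      overfull β (p₀ , β₀≡0) with gap β D
      ... | s , s≤mD , separated = q , ≤-trans βq≤s s≤mD , N≤width
        where
        -- Above the gap the product is zero, so the averaging cannot select such a joint.
        low : Fin m → Fin (suc n) → ℕ
        low p i = if does (β p ≤? s) then width β p i else 0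
        low-full : ∀ p → β p ≤ s → ∀ i → D ≤ mass β i (κ p i) (low p i + β p)
        low-full p β≤s i = subst (λ b → D ≤ mass β i (κ p i) (b + β p))
          (sym (if-yes (β p ≤? s) β≤s)) (mass-width β p i (≤-trans β≤s s≤mD))
        average = max-average (λ p → ∏ (low p)) N 0<N
          (covering β s low separated (p₀ , subst (_≤ s) (sym β₀≡0) z≤n) low-full)
        q = proj₁ average
        N≤ = proj₂ average
        is-low : Dec (β q ≤ s) → β q ≤ s
        is-low (yes β≤s) = β≤s
        is-low (no ≰) = contradiction (subst (N ≤_) empty N≤) (<⇒≱ 0<N)
          where
          empty : m * ∏ (low q) ≡ 0
          empty = trans (cong (λ b → m * (b * ∏ (low q ∘ suc))) (if-no (β q ≤? s) ≰)) (*-zeroʳ m)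
        βq≤s = is-low (β q ≤? s)
        N≤width : N ≤ m * ∏ (width β q)
        N≤width = ≤-trans N≤ (*-monoʳ-≤ m (∏-mono (low q) (width β q) (λ i → ≤-reflexive (if-yes (β q ≤? s) βq≤s))))

      Balanced : (Fin m → ℕ) → Fin m → Set
      Balanced β p = N ≤ m * ∏ (λ i → suc (width β p i))

      -- Raising the handicap of an overfull q by one keeps q balanced and only widens the others.
      raise-balanced : ∀ β q → N ≤ m * ∏ (width β q) → (∀ p → β p ≡ 0 ⊎ Balanced β p) →
        ∀ p → raise β q p ≡ 0 ⊎ Balanced (raise β q) p
      raise-balanced β q N≤q inv p with p Fin.≟ q
      ... | yes refl = inj₂ (≤-trans N≤q (*-monoʳ-≤ m (∏-mono (width β q) (λ i → suc (width (raise β q) q i)) λ i →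
              ≤-trans (∸-monoˡ-≤ (β q) (height-raise β q i (κ q i)))
                (≤-trans (∸-suc≤ _ (β q))
                  (s≤s (≤-reflexive (cong (height (raise β q) i (κ q i) ∸_) (sym (updateAt-updates q {suc} β)))))))))
      ... | no p≢q with inv p
      ...   | inj₁ β≡0 = inj₁ (trans (updateAt-minimal p q β p≢q) β≡0)
      ...   | inj₂ b = inj₂ (≤-trans b (*-monoʳ-≤ m (∏-mono (λ i → suc (width β p i)) (λ i → suc (width (raise β q) p i)) λ i → s≤s
                (≤-trans (∸-monoˡ-≤ (β p) (height-raise β q i (κ p i)))
                  (≤-reflexive (cong (height (raise β q) i (κ p i) ∸_) (sym (updateAt-minimal p q {suc} β p≢q))))))))

      -- The gap keeps every handicap at most m D + 1, so only finitely many raises occur.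
      rebalance : ∀ k β → (∀ p → β p ≤ suc (m * D)) → (∀ p → β p ≡ 0 ⊎ Balanced β p) →
        m * suc (m * D) < k + sum β → ∃ λ γ → ∀ p → Balanced γ p
      rebalance zero β β≤ _ fuel =
        contradiction (≤-trans (sum-mono β≤) (≤-reflexive (sum-const m _))) (<⇒≱ fuel)
      rebalance (suc k) β β≤ inv fuel with Fin.all? (λ p → N ≤? m * ∏ (λ i → suc (width β p i)))
      ... | yes balanced = β , balanced
      ... | no unbalanced with overfull β (unraised unbalanced)
        where
        -- By the invariant an unbalanced joint still has handicap zero, which is what `overfull`
        -- starts from.
        unraised : ¬ (∀ p → Balanced β p) → ∃ λ p → β p ≡ 0
        unraised unbalanced with Fin.¬∀⟶∃¬ m _ (λ p → N ≤? m * ∏ (λ i → suc (width β p i))) unbalanced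
        ... | p , ¬b with inv p
        ...   | inj₁ β≡0 = p , β≡0
        ...   | inj₂ b = contradiction b ¬b
      ...   | q , βq≤ , N≤q = rebalance k (raise β q) (raise≤ β q β≤ (s≤s βq≤)) (raise-balanced β q N≤q inv)
              (subst (m * suc (m * D) <_) (trans (sym (+-suc k _)) (cong (k +_) (sym (sum-raise β q)))) fuel)

      balance : ∃ λ γ → ∀ p → Balanced γ p
      balance = rebalance (suc (m * suc (m * D))) (λ _ → 0) (λ _ → z≤n) (λ _ → inj₁ refl)
        (m≤m+n _ _)

      -- One step before its `height` a line has mass at most `D`. A width exceeds its share of that
      -- mass by at most one; with the extra `suc` this costs 2 per joint.
      width-sum : ∀ β i → sum (λ p → suc (width β p i)) ≤ L i * D + m * 2
      width-sum β i = begin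
        sum (λ p → suc (width β p i))                 ≤⟨ sum-mono (λ p → suc-∸≤ (height β i (κ p i)) (β p)) ⟩
        sum (λ p → (below (κ p i) ∸ β p) + 2)
          ≡⟨ trans (∑-distrib-+ (λ p → below (κ p i) ∸ β p) (λ _ → 2)) (cong (sum (λ p → below (κ p i) ∸ β p) +_) (sum-const m 2)) ⟩
        sum (λ p → below (κ p i) ∸ β p) + m * 2
          ≡⟨ cong (_+ m * 2) (sum-cong-≗ (λ p → sum-at (κ p i) (λ l → below l ∸ β p))) ⟨
        sum (λ p → sum (λ l → at (κ p i) l (below l ∸ β p))) + m * 2
          ≡⟨ cong (_+ m * 2) (∑-comm (λ p l → at (κ p i) l (below l ∸ β p))) ⟩
        sum (λ l → mass β i l (below l)) + m * 2
          ≤⟨ +-monoˡ-≤ (m * 2) (sum-mono below-mass) ⟩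
        sum {L i} (λ _ → D) + m * 2                   ≡⟨ cong (_+ m * 2) (sum-const (L i) D) ⟩
        L i * D + m * 2                               ∎
        where
        open ≤-Reasoning
        below : Fin (L i) → ℕ
        below l = pred (height β i l)
        suc-∸≤ : ∀ h b → suc (h ∸ b) ≤ (pred h ∸ b) + 2
        suc-∸≤ zero b = ≤-trans (s≤s (≤-reflexive (0∸n≡0 b))) (≤-trans (n≤1+n 1) (m≤n+m 2 _))
        suc-∸≤ (suc h) b = ≤-trans (s≤s (∸-suc≤ (suc h) b)) (≤-reflexive (+-comm 2 _))
        below-mass : ∀ l → mass β i l (below l) ≤ D
        below-mass l with height β i l in eq
        ... | suc h = <⇒≤ (<level (mass β i l) _ (≤-reflexive (sym eq)))
        ... | zero = ≤-trans (≤-reflexive (trans (sum-cong-≗ vanish) (sum-replicate-zero m))) z≤n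
          where
          vanish : ∀ p → at (κ p i) l (0 ∸ β p) ≡ 0
          vanish p with κ p i Fin.≟ l
          ... | yes _ = 0∸n≡0 (β p)
          ... | no _ = refl

      -- Every family contains a line, so `m ≤ D` gives `m ≤ L i * D`. The rounding term `m * 2` of
      -- `width-sum` is then at most twice the main term, hence the factor 3.
      multijoint-bound : 0 < m → m ≤ D → m ^ suc n * N ≤ m * ((suc n * (3 * D)) ^ suc n * ∏ L)
      multijoint-bound 0<m m≤D with balance
      ... | β , balanced with simultaneous-markov 0<m (z<s {n}) (λ p i → suc (width β p i))
      ...   | p , p≤ = begin
        m ^ suc n * N                                      ≤⟨ *-monoʳ-≤ (m ^ suc n) (balanced p) ⟩
        m ^ suc n * (m * ∏ (λ i → suc (width β p i)))      ≡⟨ swap (m ^ suc n) m _ ⟩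
        m * (m ^ suc n * ∏ (λ i → suc (width β p i)))      ≡⟨ cong (m *_) (∏-*ˡ m (λ i → suc (width β p i))) ⟨
        m * ∏ (λ i → m * suc (width β p i))
          ≤⟨ *-monoʳ-≤ m (∏-mono (λ i → m * suc (width β p i)) (λ i → suc n * (3 * D) * L i) each) ⟩
        m * ∏ (λ i → suc n * (3 * D) * L i)                ≡⟨ cong (m *_) (∏-*ˡ (suc n * (3 * D)) L) ⟩
        m * ((suc n * (3 * D)) ^ suc n * ∏ L)              ∎
        where
        open ≤-Reasoning
        swap : ∀ a b c → a * (b * c) ≡ b * (a * c)
        swap = solve-∀
        gather : ∀ n l d → n * (l * d + l * d * 2) ≡ n * (3 * d) * l
        gather = solve-∀
        inhabited : ∀ {k} → Fin k → 0 < k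
        inhabited zero = z<s
        inhabited (suc _) = z<s
        m≤LD : ∀ i → m ≤ L i * D
        m≤LD i = ≤-trans (≤-trans m≤D (≤-reflexive (sym (*-identityˡ D)))) (*-monoˡ-≤ D (inhabited (κ p i)))
        each : ∀ i → m * suc (width β p i) ≤ suc n * (3 * D) * L i
        each i = ≤-trans (p≤ i) (≤-trans (*-monoʳ-≤ (suc n)
          (≤-trans (width-sum β i) (+-monoʳ-≤ (L i * D) (*-monoˡ-≤ 2 (m≤LD i)))))
          (≤-reflexive (gather (suc n) (L i) D)))

-- Words in the directions, up to reordering

module Words where

  open import Data.Nat as ℕ using (ℕ; zero; suc)
  import Data.Nat.Properties as ℕ
  open import Data.Fin using (Fin; zero; suc; toℕ; fromℕ<)
  import Data.Fin.Properties as Fin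
  open import Data.Product using (∃; _×_; _,_)
  open import Data.List using (List; []; _∷_; _++_; replicate; length; map)
  open import Data.List.Properties using (length-map; length-++)
  open import Data.List.Relation.Unary.All as All using (All; []; _∷_)
  import Data.List.Relation.Unary.All.Properties as All
  open import Data.List.Relation.Unary.Any using (here)
  open import Data.List.Membership.Propositional using (_∈_)
  open import Data.List.Membership.Propositional.Properties using (∈-map⁺; ∈-++⁺ˡ; ∈-++⁺ʳ)
  open import Data.List.Relation.Binary.Permutation.Propositional using (_↭_; refl; prep; trans; ↭-sym)
  open import Data.List.Relation.Binary.Permutation.Propositional.Properties using (shift; map⁺; ++⁺ˡ)
  open import Relation.Nullary using (yes; no)
  open import Relation.Binary.PropositionalEquality as ≡ hiding ([_]; trans)
  open import Function using (_∘_)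
  open import Algebra.Properties.CommutativeMonoid.Sum ℕ.+-0-commutativeMonoid using (sum; sum-cong-≗)
  open Handicaps using (∏; sum-const)

  concatFin : ∀ {A : Set} {k} → (Fin k → List A) → List A
  concatFin {k = zero} f = []
  concatFin {k = suc k} f = f zero ++ concatFin (f ∘ suc)

  length-concatFin : ∀ {A : Set} {k} (f : Fin k → List A) → length (concatFin f) ≡ sum (length ∘ f)
  length-concatFin {k = zero} f = refl
  length-concatFin {k = suc k} f = ≡.trans (length-++ (f zero)) (cong (length (f zero) ℕ.+_) (length-concatFin (f ∘ suc)))

  ∈-concatFin : ∀ {A : Set} {k} (f : Fin k → List A) i {x} → x ∈ f i → x ∈ concatFin f
  ∈-concatFin f zero x∈ = ∈-++⁺ˡ x∈
  ∈-concatFin f (suc i) x∈ = ∈-++⁺ʳ (f zero) (∈-concatFin (f ∘ suc) i x∈)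

  All-concatFin : ∀ {A : Set} {P : A → Set} {k} (f : Fin k → List A) → (∀ i → All P (f i)) → All P (concatFin f)
  All-concatFin {k = zero} f h = []
  All-concatFin {k = suc k} f h = All.++⁺ (h zero) (All-concatFin (f ∘ suc) (h ∘ suc))

  occ : ∀ {n} → Fin n → List (Fin n) → ℕ
  occ i [] = 0
  occ i (j ∷ w) with i Fin.≟ j
  ... | yes _ = suc (occ i w)
  ... | no _ = occ i w

  delete : ∀ {n} → Fin n → List (Fin n) → List (Fin n)
  delete i [] = []
  delete i (j ∷ w) with i Fin.≟ j
  ... | yes _ = delete i w
  ... | no _ = j ∷ delete i w

  -- Brings the letters `i` to the end, where a run of them becomes an iterated derivative along the
  -- `i`-th line.
  delete-↭ : ∀ {n} (i : Fin n) w → w ↭ delete i w ++ replicate (occ i w) i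
  delete-↭ i [] = refl
  delete-↭ i (j ∷ w) with i Fin.≟ j
  ... | yes refl = trans (prep i (delete-↭ i w)) (↭-sym (shift i (delete i w) (replicate (occ i w) i)))
  ... | no _ = prep j (delete-↭ i w)

  lowerWord : ∀ {n} → List (Fin (suc n)) → List (Fin n)
  lowerWord [] = []
  lowerWord (zero ∷ w) = lowerWord w
  lowerWord (suc j ∷ w) = j ∷ lowerWord w

  lowerWord-↭ : ∀ {n} (w : List (Fin (suc n))) → w ↭ replicate (occ zero w) zero ++ map suc (lowerWord w)
  lowerWord-↭ [] = refl
  lowerWord-↭ (zero ∷ w) = prep zero (lowerWord-↭ w)
  lowerWord-↭ (suc j ∷ w) = trans (prep (suc j) (lowerWord-↭ w))
    (↭-sym (shift (suc j) (replicate (occ zero w) zero) (map suc (lowerWord w))))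

  occ-lowerWord : ∀ {n} i (w : List (Fin (suc n))) → occ i (lowerWord w) ≡ occ (suc i) w
  occ-lowerWord i [] = refl
  occ-lowerWord i (zero ∷ w) = occ-lowerWord i w
  occ-lowerWord i (suc j ∷ w) with i Fin.≟ j
  ... | yes _ = cong suc (occ-lowerWord i w)
  ... | no _ = occ-lowerWord i w

  -- One sorted representative for each vector of exponents below `b`. Derivatives commute, so these
  -- words stand for all words with such exponents.
  words : ∀ n → (Fin n → ℕ) → List (List (Fin n))
  words zero b = [] ∷ []
  words (suc n) b = concatFin {k = b zero} (λ c → map (λ w → replicate (toℕ c) zero ++ map suc w) (words n (b ∘ suc)))

  length-words : ∀ n b → length (words n b) ≡ ∏ b
  length-words zero b = refl
  length-words (suc n) b = ≡.trans (length-concatFin {k = b zero} _) (≡.trans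
    (sum-cong-≗ {b zero} (λ c → ≡.trans (length-map _ (words n (b ∘ suc))) (length-words n (b ∘ suc))))
    (sum-const (b zero) (∏ (b ∘ suc))))

  words-complete : ∀ n (b : Fin n → ℕ) w → (∀ i → occ i w ℕ.< b i) → ∃ λ w′ → w′ ∈ words n b × w ↭ w′
  words-complete zero b [] h = [] , here refl , refl
  words-complete (suc n) b w h
    with words-complete n (b ∘ suc) (lowerWord w) (λ i → subst (ℕ._< b (suc i)) (sym (occ-lowerWord i w)) (h (suc i)))
  ... | w′ , w′∈ , ↭w′ = replicate (occ zero w) zero ++ map suc w′ ,
    ∈-concatFin {k = b zero} _ (fromℕ< (h zero))
      (subst (λ c → replicate (occ zero w) zero ++ map suc w′ ∈ map (λ w → replicate c zero ++ map suc w) (words n (b ∘ suc)))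
        (sym (Fin.toℕ-fromℕ< (h zero))) (∈-map⁺ _ w′∈)) ,
    trans (lowerWord-↭ w) (++⁺ˡ (replicate (occ zero w) zero) (map⁺ suc ↭w′))

-- Arithmetic and linear algebra over the reals

module Field (R : RealNumbers) where

  open import Level using (0ℓ)
  open import Data.Nat as ℕ using (ℕ; zero; suc; pred; s≤s; z<s)
  import Data.Nat.Properties as ℕ
  open import Data.Fin using (Fin; zero; suc; punchIn)
  import Data.Fin.Properties as Fin
  open import Data.Product using (∃; _×_; _,_)
  open import Data.Sum using (inj₁; inj₂)
  open import Data.List using (List; []; _∷_; length; map)
  open import Data.List.Properties using (length-map)
  open import Data.List.Relation.Unary.All as All using (All; []; _∷_)
  open import Data.List.Relation.Unary.Any using (Any)
  open import Data.List.Relation.Binary.Permutation.Propositional using (refl; trans)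
  open import Data.Vec.Functional using (insertAt)
  open import Data.Vec.Functional.Properties using (updateAt-updates; insertAt-lookup; insertAt-punchIn)
  open import Relation.Nullary using (Dec; yes; no; contradiction)
  open import Relation.Nullary.Decidable using (¬?)
  open import Relation.Binary.Definitions using (tri<; tri≈; tri>)
  open import Relation.Binary.PropositionalEquality as ≡ hiding ([_]; trans)
  open import Function using (_∘_)
  open import Algebra.Bundles using (CommutativeRing)
  open import Algebra.Properties.CommutativeMonoid.Sum ℕ.+-0-commutativeMonoid using (sum)
  open Handicaps

  open RealNumbers R hiding (_≤_)
  open Geometry R using (∑; Vec)

  commutativeRing : CommutativeRing 0ℓ 0ℓ
  commutativeRing = record { isCommutativeRing = isCommutativeRing }

  open CommutativeRing commutativeRing public using
    (+-identityˡ; +-identityʳ; +-comm; +-assoc; *-identityˡ; *-comm; *-assoc; zeroˡ; zeroʳ; distribˡ; distribʳ; -‿inverseʳ; -‿inverseˡ)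

  open import Algebra.Properties.Ring (CommutativeRing.ring commutativeRing)
    using (-‿distribˡ-*; -‿involutive)

  open import Algebra.Solver.Ring.NaturalCoefficients.Default (CommutativeRing.commutativeSemiring commutativeRing)
    using (solve; _:=_; _:+_; _:*_; con)

  infixl 6 _-_
  _-_ : ℝ → ℝ → ℝ
  x - y = x + - y

  ι : ℕ → ℝ
  ι zero = 0ℝ
  ι (suc k) = 1ℝ + ι k

  -- Trichotomy decides equality, on which the pivot search in `kernel-nontrivial` relies.
  _≟_ : ∀ x y → Dec (x ≡ y)
  x ≟ y with <-trichotomy x y
  ... | inj₁ x<y = no λ { refl → <-irrefl x x<y }
  ... | inj₂ (inj₁ x≡y) = yes x≡y
  ... | inj₂ (inj₂ y<x) = no λ { refl → <-irrefl x y<x }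

  0<1 : 0ℝ < 1ℝ
  0<1 with <-trichotomy 0ℝ 1ℝ
  ... | inj₁ 0<1 = 0<1
  ... | inj₂ (inj₁ 0≡1) = contradiction 0≡1 0≢1
  ... | inj₂ (inj₂ 1<0) = contradiction (<-trans 1<0 (subst (0ℝ <_) square (*-pos 0<-1 0<-1))) (<-irrefl 1ℝ)
    where
    0<-1 : 0ℝ < - 1ℝ
    0<-1 = subst₂ _<_ (-‿inverseʳ 1ℝ) (+-identityˡ (- 1ℝ)) (+-mono-< (- 1ℝ) 1<0)
    square : - 1ℝ * - 1ℝ ≡ 1ℝ
    square = ≡.trans (sym (-‿distribˡ-* 1ℝ (- 1ℝ))) (≡.trans (cong -_ (*-identityˡ _)) (-‿involutive 1ℝ))

  ι-mono-< : ∀ {j k} → j ℕ.< k → ι j < ι k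
  ι-mono-< {zero} {suc zero} _ = subst (0ℝ <_) (sym (+-identityʳ 1ℝ)) 0<1
  ι-mono-< {zero} {suc (suc k)} _ = <-trans (ι-mono-< {zero} {suc k} z<s)
    (subst (_< ι (suc (suc k))) (+-identityˡ _) (+-mono-< (ι (suc k)) 0<1))
  ι-mono-< {suc j} {suc k} (s≤s j<k) = subst₂ _<_ (+-comm _ 1ℝ) (+-comm _ 1ℝ) (+-mono-< 1ℝ (ι-mono-< j<k))

  -- Characteristic zero: it separates the grid points and permits division by the factor
  -- `ι (suc a)` in Leibniz' rule.
  ι-injective : ∀ {j k} → ι j ≡ ι k → j ≡ k
  ι-injective {j} {k} eq with ℕ.<-cmp j k
  ... | tri< j<k _ _ = contradiction (subst (_< ι k) eq (ι-mono-< j<k)) (<-irrefl _)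
  ... | tri≈ _ j≡k _ = j≡k
  ... | tri> _ _ k<j = contradiction (subst (ι k <_) eq (ι-mono-< k<j)) (<-irrefl _)

  ι-suc≢0 : ∀ k → ι (suc k) ≢ 0ℝ
  ι-suc≢0 k eq with ι-injective {suc k} {0} eq
  ... | ()

  *-cancel-0 : ∀ {x y} → x ≢ 0ℝ → x * y ≡ 0ℝ → y ≡ 0ℝ
  *-cancel-0 {x} {y} x≢0 xy≡0 with inverse x x≢0
  ... | z , xz≡1 = begin
    y            ≡⟨ *-identityˡ y ⟨
    1ℝ * y       ≡⟨ cong (_* y) xz≡1 ⟨
    x * z * y    ≡⟨ solve 3 (λ x z y → x :* z :* y := z :* (x :* y)) refl x z y ⟩
    z * (x * y)  ≡⟨ cong (z *_) xy≡0 ⟩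
    z * 0ℝ       ≡⟨ zeroʳ z ⟩
    0ℝ           ∎
    where open ≡-Reasoning

  x-y≢0 : ∀ {x y} → x ≢ y → x - y ≢ 0ℝ
  x-y≢0 {x} {y} x≢y eq = x≢y (begin
    x            ≡⟨ +-identityʳ x ⟨
    x + 0ℝ       ≡⟨ cong (x +_) (-‿inverseˡ y) ⟨
    x + (- y + y) ≡⟨ +-assoc x (- y) y ⟨
    x - y + y    ≡⟨ cong (_+ y) eq ⟩
    0ℝ + y       ≡⟨ +-identityˡ y ⟩
    y            ∎)
    where open ≡-Reasoning

  y+[x-y]≡x : ∀ x y → y + (x - y) ≡ x
  y+[x-y]≡x x y = ≡.trans (solve 3 (λ x y y′ → y :+ (x :+ y′) := x :+ (y :+ y′)) refl x y (- y))
    (≡.trans (cong (x +_) (-‿inverseʳ y)) (+-identityʳ x))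

  0+0≡0 : ∀ {x y} → x ≡ 0ℝ → y ≡ 0ℝ → x + y ≡ 0ℝ
  0+0≡0 refl refl = +-identityʳ 0ℝ

  x*0≡0 : ∀ {x y} → y ≡ 0ℝ → x * y ≡ 0ℝ
  x*0≡0 refl = zeroʳ _

  0+y≡y : ∀ {x y} → x ≡ 0ℝ → x + y ≡ y
  0+y≡y refl = +-identityˡ _

  x+0≡x : ∀ {x y} → y ≡ 0ℝ → x + y ≡ x
  x+0≡x refl = +-identityʳ _

  ∑-cong : ∀ {k} {f g : Fin k → ℝ} → (∀ i → f i ≡ g i) → ∑ f ≡ ∑ g
  ∑-cong {zero} h = refl
  ∑-cong {suc k} h = cong₂ _+_ (h zero) (∑-cong (h ∘ suc))

  ∑-+ : ∀ {k} (f g : Fin k → ℝ) → ∑ (λ i → f i + g i) ≡ ∑ f + ∑ g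
  ∑-+ {zero} f g = sym (+-identityʳ 0ℝ)
  ∑-+ {suc k} f g = ≡.trans (cong (f zero + g zero +_) (∑-+ (f ∘ suc) (g ∘ suc)))
    (solve 4 (λ a b c d → a :+ b :+ (c :+ d) := a :+ c :+ (b :+ d)) refl (f zero) (g zero) _ _)

  ∑-*ˡ : ∀ {k} c (f : Fin k → ℝ) → ∑ (λ i → c * f i) ≡ c * ∑ f
  ∑-*ˡ {zero} c f = sym (zeroʳ c)
  ∑-*ˡ {suc k} c f = ≡.trans (cong (c * f zero +_) (∑-*ˡ c (f ∘ suc))) (sym (distribˡ c (f zero) _))

  ∑-zero : ∀ {k} {f : Fin k → ℝ} → (∀ i → f i ≡ 0ℝ) → ∑ f ≡ 0ℝ
  ∑-zero {zero} h = refl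
  ∑-zero {suc k} h = 0+0≡0 (h zero) (∑-zero (h ∘ suc))

  ∑-only : ∀ {k} (f : Fin k → ℝ) j → (∀ i → i ≢ j → f i ≡ 0ℝ) → ∑ f ≡ f j
  ∑-only f zero h = ≡.trans (cong (f zero +_) (∑-zero (λ i → h (suc i) λ ()))) (+-identityʳ _)
  ∑-only f (suc j) h = ≡.trans (cong₂ _+_ (h zero λ ()) (∑-only (f ∘ suc) j λ i i≢j → h (suc i) (i≢j ∘ Fin.suc-injective)))
    (+-identityˡ _)

  ∑-remove : ∀ {k} (f : Fin (suc k) → ℝ) j → ∑ f ≡ f j + ∑ (f ∘ punchIn j)
  ∑-remove f zero = refl
  ∑-remove {suc k} f (suc j) = ≡.trans (cong (f zero +_) (∑-remove (f ∘ suc) j))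
    (solve 3 (λ a b c → a :+ (b :+ c) := b :+ (a :+ c)) refl (f zero) (f (suc j)) _)

  -- Gaussian elimination. The induction runs on `K` because elimination replaces the remaining rows
  -- by new ones.
  kernel-nontrivial : ∀ K {N} (rows : List (Fin N → ℝ)) → length rows ≡ K → K ℕ.< N →
    ∃ λ (a : Fin N → ℝ) → (∃ λ j → a j ≢ 0ℝ) × All (λ r → ∑ (λ j → a j * r j) ≡ 0ℝ) rows
  kernel-nontrivial _ {suc N} [] _ _ = (λ _ → 1ℝ) , (zero , 0≢1 ∘ sym) , []
  kernel-nontrivial (suc K) {suc N} (r ∷ rows) eq (s≤s short) with Fin.any? (λ j → ¬? (r j ≟ 0ℝ))
  ... | no zero-row with kernel-nontrivial K rows (ℕ.suc-injective eq) (ℕ.m<n⇒m<1+n short)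
  ...   | a , nonzero , ok = a , nonzero , ∑-zero (λ j → x*0≡0 {a j} (r≡0 j)) ∷ ok
    where
    r≡0 : ∀ j → r j ≡ 0ℝ
    r≡0 j with r j ≟ 0ℝ
    ... | yes ≡0 = ≡0
    ... | no ≢0 = contradiction (j , ≢0) zero-row
  kernel-nontrivial (suc K) {suc N} (r ∷ rows) eq (s≤s short) | yes (j , rj≢0)
    with inverse (r j) rj≢0
  ... | c , rjc≡1 with kernel-nontrivial K (map eliminate rows) (≡.trans (length-map eliminate rows) (ℕ.suc-injective eq)) short
    where
    eliminate : (Fin (suc N) → ℝ) → Fin N → ℝ
    eliminate s k = s (punchIn j k) + - (c * s j) * r (punchIn j k)
  ...   | a , (k , ak≢0) , ok = a′ , (punchIn j k , subst (_≢ 0ℝ) (sym (insertAt-punchIn a j _ k)) ak≢0) , row-r ∷ lift rows ok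
    where
    X = ∑ (λ k → a k * r (punchIn j k))
    a′ : Fin (suc N) → ℝ
    -- Since `c` inverts `r j`, this is the equation of the row `r` solved for its unknown `j`.
    a′ = insertAt a j (- c * X)
    expand : ∀ s → ∑ (λ i → a′ i * s i) ≡ - c * X * s j + ∑ (λ k → a k * s (punchIn j k))
    expand s = ≡.trans (∑-remove (λ i → a′ i * s i) j) (cong₂ _+_ (cong (_* s j) (insertAt-lookup a j _))
      (∑-cong (λ k → cong (_* s (punchIn j k)) (insertAt-punchIn a j _ k))))
    row-r : ∑ (λ i → a′ i * r i) ≡ 0ℝ
    row-r = begin
      ∑ (λ i → a′ i * r i)        ≡⟨ expand r ⟩
      - c * X * r j + X           ≡⟨ solve 3 (λ c X r → c :* X :* r :+ X := X :* (c :* r) :+ X) refl (- c) X (r j) ⟩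
      X * (- c * r j) + X
        ≡⟨ cong (λ y → X * y + X) (≡.trans (sym (-‿distribˡ-* c (r j))) (cong -_ (≡.trans (*-comm c (r j)) rjc≡1))) ⟩
      X * - 1ℝ + X                ≡⟨ solve 2 (λ X e → X :* e :+ X := X :* (con 1 :+ e)) refl X (- 1ℝ) ⟩
      X * (1ℝ + - 1ℝ)             ≡⟨ x*0≡0 (-‿inverseʳ 1ℝ) ⟩
      0ℝ                          ∎
      where open ≡-Reasoning
    lift : ∀ rows → All (λ r → ∑ (λ k → a k * r k) ≡ 0ℝ) (map _ rows) → All (λ r → ∑ (λ i → a′ i * r i) ≡ 0ℝ) rows
    lift [] [] = []
    lift (s ∷ rows) (eq ∷ ok) = ≡.trans (expand s) (≡.trans (sym reduced) eq) ∷ lift rows ok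
      where
      open ≡-Reasoning
      reduced : ∑ (λ k → a k * (s (punchIn j k) + - (c * s j) * r (punchIn j k))) ≡
                - c * X * s j + ∑ (λ k → a k * s (punchIn j k))
      reduced = begin
        ∑ (λ k → a k * (s (punchIn j k) + - (c * s j) * r (punchIn j k)))
          ≡⟨ ∑-cong (λ k → solve 4 (λ a s e r → a :* (s :+ e :* r) := e :* (a :* r) :+ a :* s) refl
               (a k) (s (punchIn j k)) (- (c * s j)) (r (punchIn j k))) ⟩
        ∑ (λ k → - (c * s j) * (a k * r (punchIn j k)) + a k * s (punchIn j k))
          ≡⟨ ∑-+ (λ k → - (c * s j) * (a k * r (punchIn j k))) (λ k → a k * s (punchIn j k)) ⟩
        ∑ (λ k → - (c * s j) * (a k * r (punchIn j k))) + ∑ (λ k → a k * s (punchIn j k))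
          ≡⟨ cong (_+ ∑ (λ k → a k * s (punchIn j k))) (∑-*ˡ (- (c * s j)) (λ k → a k * r (punchIn j k))) ⟩
        - (c * s j) * X + ∑ (λ k → a k * s (punchIn j k))
          ≡⟨ cong (_+ ∑ (λ k → a k * s (punchIn j k))) (≡.trans (cong (_* X) (-‿distribˡ-* c (s j)))
               (solve 3 (λ c s X → c :* s :* X := c :* X :* s) refl (- c) (s j) X)) ⟩
        - c * X * s j + ∑ (λ k → a k * s (punchIn j k)) ∎

  -- Polynomials in one variable and their zeros

  -- φ a stands for the a-th derivative of φ 0, a polynomial of degree < L; only division by X - τ with
  -- constant remainder, together with its Leibniz rule, is recorded.
  Poly : ℕ → (ℕ → ℝ → ℝ) → Set
  Poly zero φ = ∀ a u → φ a u ≡ 0ℝ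
  Poly (suc L) φ = ∀ τ → ∃ λ ψ → Poly L ψ ×
    (∀ u → φ 0 u ≡ φ 0 τ + (u - τ) * ψ 0 u) ×
    (∀ a u → φ (suc a) u ≡ (u - τ) * ψ (suc a) u + ι (suc a) * ψ a u)

  Poly-cong : ∀ L {φ χ} → (∀ a u → φ a u ≡ χ a u) → Poly L φ → Poly L χ
  Poly-cong zero eq h a u = ≡.trans (sym (eq a u)) (h a u)
  Poly-cong (suc L) eq h τ with h τ
  ... | ψ , hψ , e₀ , e₁ = ψ , hψ ,
    (λ u → ≡.trans (sym (eq 0 u)) (≡.trans (e₀ u) (cong (_+ _) (eq 0 τ)))) ,
    (λ a u → ≡.trans (sym (eq (suc a) u)) (e₁ a u))

  Poly-zero : ∀ L → Poly L (λ _ _ → 0ℝ)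
  Poly-zero zero a u = refl
  Poly-zero (suc L) τ = (λ _ _ → 0ℝ) , Poly-zero L ,
    (λ u → sym (0+0≡0 refl (zeroʳ _))) , (λ a u → sym (0+0≡0 (zeroʳ _) (zeroʳ _)))

  Poly-+ : ∀ L {φ χ} → Poly L φ → Poly L χ → Poly L (λ a u → φ a u + χ a u)
  Poly-+ zero hφ hχ a u = 0+0≡0 (hφ a u) (hχ a u)
  Poly-+ (suc L) {φ} {χ} hφ hχ τ with hφ τ | hχ τ
  ... | ψ , hψ , e₀ , e₁ | ω , hω , f₀ , f₁ = (λ a u → ψ a u + ω a u) , Poly-+ L hψ hω ,
    (λ u → ≡.trans (cong₂ _+_ (e₀ u) (f₀ u))
      (solve 5 (λ a b c d e → a :+ c :* d :+ (b :+ c :* e) := a :+ b :+ c :* (d :+ e)) refl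
        (φ 0 τ) (χ 0 τ) (u - τ) (ψ 0 u) (ω 0 u))) ,
    (λ a u → ≡.trans (cong₂ _+_ (e₁ a u) (f₁ a u))
      (solve 6 (λ c k d e d′ e′ → c :* d :+ k :* d′ :+ (c :* e :+ k :* e′) := c :* (d :+ e) :+ k :* (d′ :+ e′)) refl
        (u - τ) (ι (suc a)) (ψ (suc a) u) (ω (suc a) u) (ψ a u) (ω a u)))

  Poly-* : ∀ L {φ} c → Poly L φ → Poly L (λ a u → c * φ a u)
  Poly-* zero c h a u = x*0≡0 (h a u)
  Poly-* (suc L) {φ} c h τ with h τ
  ... | ψ , hψ , e₀ , e₁ = (λ a u → c * ψ a u) , Poly-* L c hψ ,
    (λ u → ≡.trans (cong (c *_) (e₀ u))
      (solve 4 (λ c a t d → c :* (a :+ t :* d) := c :* a :+ t :* (c :* d)) refl c (φ 0 τ) (u - τ) (ψ 0 u))) ,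
    (λ a u → ≡.trans (cong (c *_) (e₁ a u))
      (solve 5 (λ c t k d d′ → c :* (t :* d :+ k :* d′) := t :* (c :* d) :+ k :* (c :* d′)) refl
        c (u - τ) (ι (suc a)) (ψ (suc a) u) (ψ a u)))

  Poly-suc : ∀ L {φ} → Poly L φ → Poly (suc L) φ
  Poly-suc zero h = Poly-cong 1 (λ a u → sym (h a u)) (Poly-zero 1)
  Poly-suc (suc L) h τ with h τ
  ... | ψ , hψ , e = ψ , Poly-suc L hψ , e

  Poly-≤ : ∀ {K L φ} → K ℕ.≤ L → Poly K φ → Poly L φ
  Poly-≤ K≤L h = go (ℕ.≤⇒≤′ K≤L)
    where
    go : ∀ {L} → _ ℕ.≤′ L → Poly L _
    go (ℕ.≤′-reflexive refl) = h
    go (ℕ.≤′-step K≤L) = Poly-suc _ (go K≤L)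

  constant : ℝ → ℕ → ℝ → ℝ
  constant c zero u = c
  constant c (suc a) u = 0ℝ

  Poly-constant : ∀ L c → Poly (suc L) (constant c)
  Poly-constant L c τ = (λ _ _ → 0ℝ) , Poly-zero L ,
    (λ u → sym (≡.trans (cong (c +_) (zeroʳ _)) (+-identityʳ c))) , (λ a u → sym (0+0≡0 (zeroʳ _) (zeroʳ _)))

  -- Leibniz' rule for the product with `A + u * B`; the higher derivatives of this factor vanish,
  -- so two terms remain.
  affine* : ℝ → ℝ → (ℕ → ℝ → ℝ) → ℕ → ℝ → ℝ
  affine* A B φ zero u = (A + u * B) * φ 0 u
  affine* A B φ (suc a) u = (A + u * B) * φ (suc a) u + ι (suc a) * (B * φ a u)

  Poly-affine* : ∀ L {φ} A B → Poly L φ → Poly (suc L) (affine* A B φ)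
  Poly-affine* zero {φ} A B h = Poly-cong 1 zeros (Poly-zero 1)
    where
    zeros : ∀ a u → 0ℝ ≡ affine* A B φ a u
    zeros zero u = sym (x*0≡0 (h 0 u))
    zeros (suc a) u = sym (0+0≡0 (x*0≡0 (h (suc a) u)) (x*0≡0 (x*0≡0 (h a u))))
  Poly-affine* (suc L) {φ} A B h τ with h τ
  -- The quotient of the product by `u - τ`. In front of the remainder `φ 0 τ`, splitting
  -- `A + u * B` into `A + τ * B` and `(u - τ) * B` produces the extra constant.
  ... | ψ , hψ , e₀ , e₁ = (λ a u → affine* A B ψ a u + constant (B * φ 0 τ) a u) ,
        Poly-+ (suc L) {affine* A B ψ} {constant (B * φ 0 τ)} (Poly-affine* L A B hψ) (Poly-constant L (B * φ 0 τ)) , f₀ , f₁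
    where
    open ≡-Reasoning
    f₀ : ∀ u → (A + u * B) * φ 0 u ≡ (A + τ * B) * φ 0 τ + (u - τ) * ((A + u * B) * ψ 0 u + B * φ 0 τ)
    f₀ u = begin
      (A + u * B) * φ 0 u
        ≡⟨ cong ((A + u * B) *_) (e₀ u) ⟩
      (A + u * B) * (φ 0 τ + w * ψ 0 u)
        ≡⟨ distribˡ (A + u * B) (φ 0 τ) (w * ψ 0 u) ⟩
      (A + u * B) * φ 0 τ + (A + u * B) * (w * ψ 0 u)
        ≡⟨ cong (λ z → (A + z * B) * φ 0 τ + (A + u * B) * (w * ψ 0 u)) (y+[x-y]≡x u τ) ⟨
      (A + (τ + w) * B) * φ 0 τ + (A + u * B) * (w * ψ 0 u)
        ≡⟨ solve 7 (λ A B τ w f u p → (A :+ (τ :+ w) :* B) :* f :+ (A :+ u :* B) :* (w :* p) :=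
             (A :+ τ :* B) :* f :+ w :* ((A :+ u :* B) :* p :+ B :* f)) refl A B τ w (φ 0 τ) u (ψ 0 u) ⟩
      (A + τ * B) * φ 0 τ + w * ((A + u * B) * ψ 0 u + B * φ 0 τ) ∎
      where w = u - τ
    f₁ : ∀ a u → affine* A B φ (suc a) u ≡
      (u - τ) * (affine* A B ψ (suc a) u + 0ℝ) + ι (suc a) * (affine* A B ψ a u + constant (B * φ 0 τ) a u)
    f₁ zero u = ≡.trans (cong₂ (λ x y → (A + u * B) * x + ι 1 * (B * y)) (e₁ 0 u) (e₀ u))
      (solve 6 (λ l w B f p₀ p₁ →
        l :* (w :* p₁ :+ (con 1 :+ con 0) :* p₀) :+ (con 1 :+ con 0) :* (B :* (f :+ w :* p₀)) :=
        w :* (l :* p₁ :+ (con 1 :+ con 0) :* (B :* p₀) :+ con 0) :+ (con 1 :+ con 0) :* (l :* p₀ :+ B :* f)) refl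
        (A + u * B) (u - τ) B (φ 0 τ) (ψ 0 u) (ψ 1 u))
    f₁ (suc a) u = ≡.trans (cong₂ (λ x y → (A + u * B) * x + ι (suc (suc a)) * (B * y)) (e₁ (suc a) u) (e₁ a u))
      (solve 7 (λ l w B k p₀ p₁ p₂ →
        l :* (w :* p₂ :+ (con 1 :+ k) :* p₁) :+ (con 1 :+ k) :* (B :* (w :* p₁ :+ k :* p₀)) :=
        w :* (l :* p₂ :+ (con 1 :+ k) :* (B :* p₁) :+ con 0) :+ (con 1 :+ k) :* (l :* p₁ :+ k :* (B :* p₀) :+ con 0)) refl
        (A + u * B) (u - τ) B (ι (suc a)) (ψ a u) (ψ (suc a) u) (ψ (suc (suc a)) u))

  -- Dividing by `u - τ i` costs one multiplicity at `τ i` and none elsewhere. Distinctness is asked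
  -- only where multiplicities are positive, so an index contributing no zero may carry any `τ`.
  roots-exceed-degree : ∀ L {φ} → Poly L φ → ∀ {k} (τ : Fin k → ℝ) (μ : Fin k → ℕ) →
    (∀ i j → i ≢ j → 0 ℕ.< μ i → 0 ℕ.< μ j → τ i ≢ τ j) →
    (∀ i a → a ℕ.< μ i → φ a (τ i) ≡ 0ℝ) → L ℕ.≤ sum μ → ∀ a u → φ a u ≡ 0ℝ
  roots-exceed-degree zero h τ μ distinct root L≤ = h
  roots-exceed-degree (suc L) {φ} h τ μ distinct root L≤ with sum-positive μ (ℕ.≤-trans z<s L≤)
  ... | i , 0<μi with h (τ i)
  ...   | ψ , hψ , e₀ , e₁ = conclude
    where
    -- Leibniz' rule at `τ j` ties each derivative of `ψ` to the preceding one, so they vanish in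
    -- turn because `τ j - τ i` is nonzero.
    at-other : ∀ j → j ≢ i → ∀ a → a ℕ.< μ j → ψ a (τ j) ≡ 0ℝ
    at-other j j≢i a a<μ = *-cancel-0 (x-y≢0 (distinct j i j≢i (ℕ.≤-trans z<s a<μ) 0<μi)) (vanish a a<μ)
      where
      vanish : ∀ a → a ℕ.< μ j → (τ j - τ i) * ψ a (τ j) ≡ 0ℝ
      vanish zero a<μ = ≡.trans (sym (≡.trans (e₀ (τ j)) (0+y≡y (root i 0 0<μi)))) (root j 0 a<μ)
      vanish (suc a) a<μ = ≡.trans
        (sym (≡.trans (e₁ a (τ j)) (x+0≡x (x*0≡0 (*-cancel-0 (x-y≢0 (distinct j i j≢i (ℕ.≤-trans z<s a<μ) 0<μi)) (vanish a (ℕ.<⇒≤ a<μ)))))))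
        (root j (suc a) a<μ)
    -- At `τ i` the first Leibniz term drops out and `ι (suc a)` cancels; the shift from `suc a` to
    -- `a` is the lost multiplicity.
    at-same : ∀ a → suc a ℕ.< μ i → ψ a (τ i) ≡ 0ℝ
    at-same a a<μ = *-cancel-0 (ι-suc≢0 a) (≡.trans
      (sym (≡.trans (e₁ a (τ i)) (0+y≡y (≡.trans (*-comm _ _) (x*0≡0 (-‿inverseʳ (τ i)))))))
      (root i (suc a) a<μ))
    root′ : ∀ j a → a ℕ.< lower μ i j → ψ a (τ j) ≡ 0ℝ
    root′ j a a< with j Fin.≟ i
    ... | no j≢i = at-other j j≢i a (ℕ.<-≤-trans a< (lower≤ μ i j))
    ... | yes refl = at-same a (below (subst (a ℕ.<_) (updateAt-updates j {pred} μ) a<))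
      where
      below : ∀ {x} → a ℕ.< pred x → suc a ℕ.< x
      below {suc x} = s≤s
    ψ≡0 : ∀ a u → ψ a u ≡ 0ℝ
    ψ≡0 = roots-exceed-degree L hψ τ (lower μ i)
      (λ j k j≢k 0<j 0<k → distinct j k j≢k (ℕ.<-≤-trans 0<j (lower≤ μ i j)) (ℕ.<-≤-trans 0<k (lower≤ μ i k)))
      root′ (ℕ.s≤s⁻¹ (subst (suc L ℕ.≤_) (sum-lower μ i 0<μi) L≤))
    conclude : ∀ a u → φ a u ≡ 0ℝ
    conclude zero u = ≡.trans (e₀ u) (0+0≡0 (root i 0 0<μi) (x*0≡0 (ψ≡0 0 u)))
    conclude (suc a) u = ≡.trans (e₁ a u) (0+0≡0 (x*0≡0 (ψ≡0 (suc a) u)) (x*0≡0 (ψ≡0 a u)))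

-- Polynomials in several variables as families of derivatives

module Joints (R : RealNumbers) where

  open import Data.Nat as ℕ using (ℕ; zero; suc; z≤n; s≤s; z<s)
  import Data.Nat.Properties as ℕ
  open import Data.Fin using (Fin; zero; suc; toℕ; combine; finToFun; funToFin)
  import Data.Fin.Properties as Fin
  open import Data.Product using (∃; _×_; _,_; proj₁; proj₂)
  open import Data.Sum using (_⊎_; inj₁; inj₂)
  open import Data.List using (List; []; _∷_; _++_; replicate; length; map; foldr; allFin; filter)
  open import Data.List.Properties using (length-map; map-++; map-replicate; length-++; length-replicate; length-filter;
    length-tabulate; ++-identityʳ)
  open import Data.List.Relation.Unary.All as All using (All; []; _∷_)
  import Data.List.Relation.Unary.All.Properties as All
  open import Data.List.Relation.Unary.Any using (here; there)
  open import Data.List.Membership.Propositional using (_∈_)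
  open import Data.List.Membership.Propositional.Properties using (∈-map⁺; ∈-filter⁺; ∈-allFin)
  open import Data.List.Relation.Binary.Permutation.Propositional using (_↭_; refl; prep; swap; trans; ↭-sym)
  open import Data.List.Relation.Binary.Permutation.Propositional.Properties using (shift; map⁺; ↭-length)
  open import Relation.Nullary using (¬_; Dec; yes; no; contradiction)
  open import Relation.Nullary.Decidable using (¬?)
  open import Relation.Binary.PropositionalEquality as ≡ hiding ([_]; trans)
  open import Function using (_∘_)
  open import Data.Nat.Tactic.RingSolver using (solve-∀)
  open import Algebra.Properties.CommutativeMonoid.Sum ℕ.+-0-commutativeMonoid using (sum; sum-cong-≗)
  open Handicaps
  open Words

  open RealNumbers R using (ℝ; _+_; _*_; -_; 0ℝ; 1ℝ; 0≢1)
  open Geometry R using (∑; Vec; Spans; _≢ᵖ_)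
  open Field R
  open import Algebra.Bundles using (CommutativeRing)
  open import Algebra.Solver.Ring.NaturalCoefficients.Default (CommutativeRing.commutativeSemiring commutativeRing)
    using (solve; _:=_; _:+_; _:*_; con)

  -- F (u₁ ∷ … ∷ uₖ ∷ []) x stands for the iterated directional derivative ∂_{u₁} … ∂_{uₖ} F at x.
  Jet : ℕ → Set
  Jet n = List (Vec n) → Vec n → ℝ

  along : ∀ {n} → Jet n → List (Vec n) → Vec n → Vec n → ℕ → ℝ → ℝ
  along F us p v a y = F (us ++ replicate a v) (λ k → p k + y * v k)

  Symmetric : ∀ {n} → Jet n → Set
  Symmetric F = ∀ {us us′} → us ↭ us′ → ∀ x → F us x ≡ F us′ x

  -- The relation on `w` is coordinatewise, the form in which `Spans` delivers coefficients;
  -- pointwise equal vectors need not be equal as functions.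
  Linear : ∀ {n} → Jet n → Set
  Linear {n} F = ∀ {k} (a : Fin k → ℝ) (v : Fin k → Vec n) w → (∀ j → w j ≡ ∑ (λ i → a i * v i j)) →
    ∀ us x → F (w ∷ us) x ≡ ∑ (λ i → a i * F (v i ∷ us) x)

  -- The field `degree` covers the restrictions of all derivatives, since `along-line` counts the
  -- zeros of a derivative in other directions.
  record IsPolynomial {n} (L : ℕ) (F : Jet n) : Set where
    field
      ext       : ∀ us {x y} → (∀ k → x k ≡ y k) → F us x ≡ F us y
      symmetric : Symmetric F
      linear    : Linear F
      degree    : ∀ us p v → Poly L (along F us p v)
  open IsPolynomial

  module _ {n : ℕ} where

    private
      ∂ : Vec n → Jet n → Jet n
      ∂ u F us = F (u ∷ us)

    ∂-polynomial : ∀ {L F} u → IsPolynomial L F → IsPolynomial L (∂ u F)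
    ∂-polynomial u h = record
      { ext = λ us → ext h (u ∷ us)
      ; symmetric = λ us↭ → symmetric h (prep u us↭)
      ; linear = λ a v w eq us x → ≡.trans (symmetric h (swap u w refl) x) (≡.trans (linear h a v w eq (u ∷ us) x)
          (∑-cong (λ i → cong (a i *_) (symmetric h (swap (v i) u refl) x))))
      ; degree = λ us → degree h (u ∷ us)
      }

    polynomial-≤ : ∀ {K L F} → K ℕ.≤ L → IsPolynomial {n} K F → IsPolynomial L F
    polynomial-≤ K≤L h = record
      { ext = ext h ; symmetric = symmetric h ; linear = linear h ; degree = λ us p v → Poly-≤ K≤L (degree h us p v) }

    combination : ∀ {N} → (Fin N → ℝ) → (Fin N → Jet n) → Jet n
    combination a F us x = ∑ (λ δ → a δ * F δ us x)

    combination-polynomial : ∀ {N L} (a : Fin N → ℝ) (F : Fin N → Jet n) →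
      (∀ δ → IsPolynomial L (F δ)) → IsPolynomial L (combination a F)
    combination-polynomial {zero} a F h = record
      { ext = λ _ _ → refl ; symmetric = λ _ _ → refl
      ; linear = λ b v w eq us x → sym (∑-zero (λ i → zeroʳ (b i)))
      ; degree = λ us p v → Poly-zero _ }
    combination-polynomial {suc N} {L} a F h = record
      { ext = λ us eq → cong₂ _+_ (cong (a zero *_) (ext (h zero) us eq)) (ext rest us eq)
      ; symmetric = λ us↭ x → cong₂ _+_ (cong (a zero *_) (symmetric (h zero) us↭ x)) (symmetric rest us↭ x)
      ; linear = λ b v w eq us x → ≡.trans
          (cong₂ _+_ (≡.trans (cong (a zero *_) (linear (h zero) b v w eq us x)) (sym (∑-*ˡ (a zero) (λ i → b i * F zero (v i ∷ us) x))))
            (linear rest b v w eq us x))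
          (≡.trans (sym (∑-+ (λ i → a zero * (b i * F zero (v i ∷ us) x)) (λ i → b i * combination (a ∘ suc) (F ∘ suc) (v i ∷ us) x)))
            (∑-cong (λ i → solve 4 (λ a b f g → a :* (b :* f) :+ b :* g := b :* (a :* f :+ g)) refl
              (a zero) (b i) (F zero (v i ∷ us) x) (combination (a ∘ suc) (F ∘ suc) (v i ∷ us) x))))
      ; degree = λ us p v → Poly-+ L {λ c y → a zero * along (F zero) us p v c y} {along (combination (a ∘ suc) (F ∘ suc)) us p v}
          (Poly-* L (a zero) (degree (h zero) us p v)) (degree rest us p v)
      }
      where rest = combination-polynomial (a ∘ suc) (F ∘ suc) (h ∘ suc)

    one : Jet n
    one [] x = 1ℝ
    one (_ ∷ _) x = 0ℝ

    one-polynomial : IsPolynomial 1 one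
    one-polynomial = record
      { ext = one-ext ; symmetric = one-symmetric
      ; linear = λ a v w eq us x → sym (∑-zero (λ i → zeroʳ (a i)))
      ; degree = one-degree }
      where
      one-ext : ∀ us {x y : Vec n} → (∀ k → x k ≡ y k) → one us x ≡ one us y
      one-ext [] _ = refl
      one-ext (_ ∷ _) _ = refl
      one-symmetric : Symmetric one
      one-symmetric refl x = refl
      one-symmetric (prep _ _) x = refl
      one-symmetric (swap _ _ _) x = refl
      one-symmetric (trans p q) x = ≡.trans (one-symmetric p x) (one-symmetric q x)
      one-degree : ∀ us p v → Poly 1 (along one us p v)
      one-degree (_ ∷ _) p v = Poly-zero 1
      one-degree [] p v = Poly-cong 1 same (Poly-constant 0 1ℝ)
        where
        same : ∀ a y → constant 1ℝ a y ≡ along one [] p v a y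
        same zero y = refl
        same (suc a) y = refl

    -- Leibniz' rule for the product of F with the coordinate function x ↦ x j - c.
    factor* : Fin n → ℝ → Jet n → Jet n
    factor* j c F [] x = (x j - c) * F [] x
    factor* j c F (u ∷ us) x = u j * F us x + factor* j c (∂ u F) us x

    module _ (j : Fin n) (c : ℝ) where

      factor*-cong : ∀ {F G : Jet n} → (∀ us x → F us x ≡ G us x) → ∀ us x → factor* j c F us x ≡ factor* j c G us x
      factor*-cong eq [] x = cong ((x j - c) *_) (eq [] x)
      factor*-cong eq (u ∷ us) x = cong₂ _+_ (cong (u j *_) (eq us x)) (factor*-cong (λ us → eq (u ∷ us)) us x)

      factor*-combination : ∀ {k} (a : Fin k → ℝ) (G : Fin k → Jet n) us x →
        factor* j c (combination a G) us x ≡ ∑ (λ i → a i * factor* j c (G i) us x)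
      factor*-combination a G [] x = ≡.trans (sym (∑-*ˡ (x j - c) (λ i → a i * G i [] x)))
        (∑-cong (λ i → solve 3 (λ t a g → t :* (a :* g) := a :* (t :* g)) refl (x j - c) (a i) (G i [] x)))
      factor*-combination a G (u ∷ us) x = ≡.trans
        (cong₂ _+_ (sym (∑-*ˡ (u j) (λ i → a i * G i us x))) (factor*-combination a (∂ u ∘ G) us x))
        (≡.trans (sym (∑-+ (λ i → u j * (a i * G i us x)) (λ i → a i * factor* j c (∂ u (G i)) us x)))
          (∑-cong (λ i → solve 4 (λ t a g h → t :* (a :* g) :+ a :* h := a :* (t :* g :+ h)) refl
            (u j) (a i) (G i us x) (factor* j c (∂ u (G i)) us x))))

      factor*-ext : ∀ {L} {F : Jet n} → IsPolynomial L F → ∀ us {x y} → (∀ k → x k ≡ y k) → factor* j c F us x ≡ factor* j c F us y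
      factor*-ext h [] eq = cong₂ _*_ (cong (_- c) (eq j)) (ext h [] eq)
      factor*-ext h (u ∷ us) eq = cong₂ _+_ (cong (u j *_) (ext h us eq)) (factor*-ext (∂-polynomial u h) us eq)

      factor*-symmetric : ∀ {L} {F : Jet n} → IsPolynomial L F → Symmetric (factor* j c F)
      factor*-symmetric h refl x = refl
      factor*-symmetric h (prep u p) x = cong₂ _+_ (cong (u j *_) (symmetric h p x)) (factor*-symmetric (∂-polynomial u h) p x)
      factor*-symmetric {F = F} h (swap {us} {us′} u w p) x = begin
        u j * F (w ∷ us) x + (w j * F (u ∷ us) x + factor* j c (∂ w (∂ u F)) us x)
          ≡⟨ cong₂ (λ y z → u j * y + z) (symmetric h (prep w p) x)
               (cong₂ (λ y z → w j * y + z) (symmetric h (prep u p) x)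
                 (≡.trans (factor*-cong (λ vs y → symmetric h (swap u w refl) y) us x)
                   (factor*-symmetric (∂-polynomial u (∂-polynomial w h)) p x))) ⟩
        u j * F (w ∷ us′) x + (w j * F (u ∷ us′) x + factor* j c (∂ u (∂ w F)) us′ x)
          ≡⟨ solve 3 (λ a b d → a :+ (b :+ d) := b :+ (a :+ d)) refl (u j * F (w ∷ us′) x) (w j * F (u ∷ us′) x) _ ⟩
        w j * F (u ∷ us′) x + (u j * F (w ∷ us′) x + factor* j c (∂ u (∂ w F)) us′ x) ∎
        where open ≡-Reasoning
      factor*-symmetric h (trans p q) x = ≡.trans (factor*-symmetric h p x) (factor*-symmetric h q x)

      factor*-linear : ∀ {L} {F : Jet n} → IsPolynomial L F → Linear (factor* j c F)
      factor*-linear {F = F} h a v w eq us x = begin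
        w j * F us x + factor* j c (∂ w F) us x
          ≡⟨ cong₂ _+_ (≡.trans (cong (_* F us x) (eq j)) (≡.trans (*-comm _ (F us x)) (sym (∑-*ˡ (F us x) (λ i → a i * v i j)))))
               (≡.trans (factor*-cong (linear h a v w eq) us x) (factor*-combination a (λ i → ∂ (v i) F) us x)) ⟩
        ∑ (λ i → F us x * (a i * v i j)) + ∑ (λ i → a i * factor* j c (∂ (v i) F) us x)
          ≡⟨ ∑-+ (λ i → F us x * (a i * v i j)) (λ i → a i * factor* j c (∂ (v i) F) us x) ⟨
        ∑ (λ i → F us x * (a i * v i j) + a i * factor* j c (∂ (v i) F) us x)
          ≡⟨ ∑-cong (λ i → solve 4 (λ f a v g → f :* (a :* v) :+ a :* g := a :* (v :* f :+ g)) refl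
               (F us x) (a i) (v i j) (factor* j c (∂ (v i) F) us x)) ⟩
        ∑ (λ i → a i * (v i j * F us x + factor* j c (∂ (v i) F) us x)) ∎
        where open ≡-Reasoning

      -- For a repeated direction the Leibniz terms coincide and merge into `ι (suc a)`, which
      -- matches `affine*`.
      factor*-replicate : ∀ (F : Jet n) v a x → factor* j c F (replicate (suc a) v) x ≡
        (x j - c) * F (replicate (suc a) v) x + ι (suc a) * (v j * F (replicate a v) x)
      factor*-replicate F v zero x = solve 3 (λ e f g → e :* f :+ g := g :+ (con 1 :+ con 0) :* (e :* f)) refl (v j) (F [] x) _
      factor*-replicate F v (suc a) x = ≡.trans (cong (v j * F (replicate (suc a) v) x +_) (factor*-replicate (∂ v F) v a x))
        (solve 4 (λ e f g k → e :* f :+ (g :+ k :* (e :* f)) := g :+ (con 1 :+ k) :* (e :* f)) refl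
          (v j) (F (replicate (suc a) v) x) _ (ι (suc a)))

      factor*-degree : ∀ {L} {F : Jet n} → IsPolynomial L F → ∀ us p v → Poly (suc L) (along (factor* j c F) us p v)
      factor*-degree {L} {F} h (u ∷ us) p v = Poly-+ (suc L) {λ a y → u j * along F us p v a y} {along (factor* j c (∂ u F)) us p v}
        (Poly-suc L (Poly-* L (u j) (degree h us p v))) (factor*-degree (∂-polynomial u h) us p v)
      factor*-degree {L} {F} h [] p v = Poly-cong (suc L) same (Poly-affine* L (p j - c) (v j) (degree h [] p v))
        where
        shifted : ∀ y → p j - c + y * v j ≡ p j + y * v j - c
        shifted y = solve 3 (λ p c e → p :+ c :+ e := p :+ e :+ c) refl (p j) (- c) (y * v j)
        same : ∀ a y → affine* (p j - c) (v j) (along F [] p v) a y ≡ along (factor* j c F) [] p v a y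
        same zero y = cong (_* along F [] p v 0 y) (shifted y)
        same (suc a) y = ≡.trans (cong (λ s → s * along F [] p v (suc a) y + ι (suc a) * (v j * along F [] p v a y)) (shifted y))
          (sym (factor*-replicate F v a (λ k → p k + y * v k)))

      factor*-polynomial : ∀ {L F} → IsPolynomial L F → IsPolynomial (suc L) (factor* j c F)
      factor*-polynomial h = record
        { ext = factor*-ext h ; symmetric = factor*-symmetric h ; linear = factor*-linear h ; degree = factor*-degree h }

    product : List (Fin n × ℝ) → Jet n
    product = foldr (λ (j , c) → factor* j c) one

    product-polynomial : ∀ fs → IsPolynomial (suc (length fs)) (product fs)
    product-polynomial [] = one-polynomial
    product-polynomial ((j , c) ∷ fs) = factor*-polynomial j c (product-polynomial fs)

    product-zero : ∀ {fs j c x} → (j , c) ∈ fs → x j ≡ c → product fs [] x ≡ 0ℝ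
    product-zero {j = j} {c} (here refl) refl = ≡.trans (*-comm _ _) (x*0≡0 (-‿inverseʳ c))
    product-zero (there ∈fs) eq = x*0≡0 (product-zero ∈fs eq)

    product-nonzero : ∀ {fs x} → All (λ (j , c) → x j ≢ c) fs → product fs [] x ≢ 0ℝ
    product-nonzero [] eq = 0≢1 (sym eq)
    product-nonzero (≢c ∷ all) eq = product-nonzero all (*-cancel-0 (x-y≢0 ≢c) eq)

    -- Directions are expanded in `v` one at a time. Symmetry moves each resulting letter to the
    -- part already written in `v`, and the total order stays `r`.
    vanishes-by-spanning : ∀ {L F} → IsPolynomial L F → (v : Fin n → Vec n) → Spans v → ∀ x r →
      (∀ w → length w ≡ r → F (map v w) x ≡ 0ℝ) →
      ∀ us w → length us ℕ.+ length w ≡ r → F (us ++ map v w) x ≡ 0ℝ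
    vanishes-by-spanning h v spans x r van [] w eq = van w eq
    vanishes-by-spanning {F = F} h v spans x r van (u ∷ us) w eq with spans u
    ... | a , u≡ = ≡.trans (linear h a v u u≡ (us ++ map v w) x) (∑-zero (λ i → x*0≡0
      (≡.trans (symmetric h (↭-sym (shift (v i) us (map v w))) x)
        (vanishes-by-spanning h v spans x r van us (i ∷ w) (≡.trans (ℕ.+-suc (length us) (length w)) eq)))))

  -- Lagrange polynomials on a grid

  module Lagrange (n E : ℕ) where

    node : Fin (E ℕ.^ n) → Vec n
    node δ j = ι (toℕ (finToFun δ j))

    -- The numerator of a Lagrange polynomial, left unnormalised: a nonzero value at its own node is
    -- enough for independence.
    factorsAt : Fin (E ℕ.^ n) → Fin n → List (Fin n × ℝ)
    factorsAt δ j = map (λ k → j , ι (toℕ k)) (filter (λ k → ¬? (finToFun δ j Fin.≟ k)) (allFin E))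

    factors : Fin (E ℕ.^ n) → List (Fin n × ℝ)
    factors δ = concatFin (factorsAt δ)

    length-factors : ∀ δ → length (factors δ) ℕ.≤ n ℕ.* E
    length-factors δ = ℕ.≤-trans (ℕ.≤-reflexive (length-concatFin (factorsAt δ))) (ℕ.≤-trans
      (sum-mono {n} {length ∘ factorsAt δ} {λ _ → E} at-most)
      (ℕ.≤-reflexive (sum-const n E)))
      where
      at-most : ∀ j → length (factorsAt δ j) ℕ.≤ E
      at-most j = begin
        length (factorsAt δ j)        ≡⟨ length-map _ (filter (λ k → ¬? (finToFun δ j Fin.≟ k)) (allFin E)) ⟩
        length (filter (λ k → ¬? (finToFun δ j Fin.≟ k)) (allFin E))
                                      ≤⟨ length-filter (λ k → ¬? (finToFun δ j Fin.≟ k)) (allFin E) ⟩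
        length (allFin E)             ≡⟨ length-tabulate {n = E} (λ k → k) ⟩
        E                             ∎
        where open ℕ.≤-Reasoning

    basis : Fin (E ℕ.^ n) → Jet n
    basis δ = product (factors δ)

    basis-polynomial : ∀ δ → IsPolynomial (suc (n ℕ.* E)) (basis δ)
    basis-polynomial δ = polynomial-≤ (s≤s (length-factors δ)) (product-polynomial (factors δ))

    basis-own : ∀ δ → basis δ [] (node δ) ≢ 0ℝ
    basis-own δ = product-nonzero (All-concatFin (factorsAt δ) (λ j → All.map⁺
      (All.map (λ ≢k eq → ≢k (Fin.toℕ-injective (ι-injective eq))) (All.all-filter (λ k → ¬? (finToFun δ j Fin.≟ k)) (allFin E)))))

    basis-other : ∀ δ ε → δ ≢ ε → basis δ [] (node ε) ≡ 0ℝ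
    basis-other δ ε δ≢ε with Fin.any? (λ j → ¬? (finToFun {E} {n} δ j Fin.≟ finToFun ε j))
    ... | yes (j , ≢) = product-zero (∈-concatFin (factorsAt δ) j (∈-map⁺ _
            (∈-filter⁺ (λ k → ¬? (finToFun δ j Fin.≟ k)) (∈-allFin (finToFun ε j)) ≢))) refl
    ... | no agree = contradiction (begin
      δ                               ≡⟨ Fin.funToFin-finToFin {n} {E} δ ⟨
      funToFin (finToFun {E} {n} δ)   ≡⟨ funToFin-cong same ⟩
      funToFin (finToFun {E} {n} ε)   ≡⟨ Fin.funToFin-finToFin {n} {E} ε ⟩
      ε                               ∎) δ≢ε
      where
      open ≡-Reasoning
      same : ∀ j → finToFun δ j ≡ finToFun ε j
      same j with finToFun {E} {n} δ j Fin.≟ finToFun ε j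
      ... | yes eq = eq
      ... | no ≢ = contradiction (j , ≢) agree
      funToFin-cong : ∀ {m n} {f g : Fin m → Fin n} → (∀ j → f j ≡ g j) → funToFin f ≡ funToFin g
      funToFin-cong {zero} eq = refl
      funToFin-cong {suc m} eq = cong₂ combine (eq zero) (funToFin-cong (eq ∘ suc))

  -- Propagation of vanishing orders from joint to joint

  module _ {m n} {K : Fin (suc n) → ℕ} (κ : Fin m → (i : Fin (suc n)) → Fin (K i))
    (x : Fin m → Vec (suc n)) (v : Fin m → Fin (suc n) → Vec (suc n))
    (distinct : ∀ p q → p ≢ q → x p ≢ᵖ x q)
    (collinear : ∀ p q i → κ q i ≡ κ p i → ∃ λ τ → ∀ k → x q k ≡ x p k + τ * v p i k)
    (spanning : ∀ p → Spans (v p)) where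

    module Vanishing {D} (β : Fin m → ℕ) (s : ℕ) (b : Fin m → Fin (suc n) → ℕ)
      (separated : ∀ p → β p ℕ.≤ s ⊎ s ℕ.+ D ℕ.≤ β p)
      (heavy : ∀ p → β p ℕ.≤ s → ∀ i → D ℕ.≤ Balance.mass κ D 0 β i (κ p i) (b p i ℕ.+ β p))
      {F : Jet (suc n)} (poly : IsPolynomial D F)
      (conditions : ∀ p w → w ∈ words (suc n) (b p) → F (map (v p) w) (x p) ≡ 0ℝ) where

      VanishesAt : ℕ → Set
      VanishesAt t = ∀ p us → length us ℕ.< t ℕ.∸ β p → F us (x p) ≡ 0ℝ

      -- A derivative taken often along the i-th line of p vanishes, since its restriction to that line has too many zeros.
      along-line : ∀ t → VanishesAt t → ∀ p → β p ℕ.≤ s → ∀ i rest a → a ℕ.+ length rest ℕ.+ β p ≡ t → b p i ℕ.≤ a →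
        F (rest ++ replicate a (v p i)) (x p) ≡ 0ℝ
      along-line t van p β≤s i rest a refl b≤a = ≡.trans
        (ext poly (rest ++ replicate a (v p i)) (λ k → sym (x+0≡x (≡.trans (*-comm 0ℝ _) (zeroʳ _)))))
        (roots-exceed-degree D (degree poly rest (x p) (v p i)) τ μ τ-distinct roots enough a 0ℝ)
        where
        r = length rest
        -- Joints off the line receive the parameter 0. Their multiplicity `μ` is zero, so the clash
        -- with `p` is harmless.
        on-line : ∀ q → Dec (κ q i ≡ κ p i) → ℝ
        on-line q (yes same) = proj₁ (collinear p q i same)
        on-line q (no _) = 0ℝ
        τ : Fin m → ℝ
        τ q = on-line q (κ q i Fin.≟ κ p i)
        τ-spec : ∀ q → κ q i ≡ κ p i → ∀ k → x q k ≡ x p k + τ q * v p i k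
        τ-spec q same = go (κ q i Fin.≟ κ p i)
          where
          go : ∀ d k → x q k ≡ x p k + on-line q d * v p i k
          go (yes same) = proj₂ (collinear p q i same)
          go (no ≢) = contradiction same ≢
        -- Differentiating in the directions `rest` costs `r` orders at every joint.
        order : Fin m → ℕ
        order q = t ℕ.∸ β q ℕ.∸ r
        μ : Fin m → ℕ
        μ q = at (κ q i) (κ p i) (order q)
        0<μ⇒same : ∀ q → 0 ℕ.< μ q → κ q i ≡ κ p i
        0<μ⇒same q 0<μ with κ q i Fin.≟ κ p i
        ... | yes same = same
        μ≤order : ∀ q → μ q ℕ.≤ order q
        μ≤order q with κ q i Fin.≟ κ p i
        ... | yes _ = ℕ.≤-refl
        ... | no _ = z≤n
        τ-distinct : ∀ q q′ → q ≢ q′ → 0 ℕ.< μ q → 0 ℕ.< μ q′ → τ q ≢ τ q′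
        τ-distinct q q′ q≢q′ 0<μ 0<μ′ eq = distinct q q′ q≢q′ λ k → begin
          x q k                       ≡⟨ τ-spec q (0<μ⇒same q 0<μ) k ⟩
          x p k + τ q * v p i k       ≡⟨ cong (λ y → x p k + y * v p i k) eq ⟩
          x p k + τ q′ * v p i k      ≡⟨ τ-spec q′ (0<μ⇒same q′ 0<μ′) k ⟨
          x q′ k                      ∎
          where open ≡-Reasoning
        roots : ∀ q c → c ℕ.< μ q → along F rest (x p) (v p i) c (τ q) ≡ 0ℝ
        roots q c c<μ = ≡.trans
          (ext poly (rest ++ replicate c (v p i)) (λ k → sym (τ-spec q (0<μ⇒same q (ℕ.≤-trans z<s c<μ)) k)))
          (van q (rest ++ replicate c (v p i)) (subst (ℕ._< t ℕ.∸ β q)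
            (sym (≡.trans (length-++ rest) (cong (r ℕ.+_) (length-replicate c))))
            (below (ℕ.≤-trans c<μ (μ≤order q)))))
          where
          below : c ℕ.< order q → r ℕ.+ c ℕ.< t ℕ.∸ β q
          below c< = ℕ.≰⇒> λ le → ℕ.<⇒≱ c< (ℕ.m≤n+o⇒m∸n≤o _ r le)
        -- Here `t ∸ r` equals `a + β p`, so it is at least the level `b p i + β p` at which `heavy`
        -- finds total order `D` on this line.
        level≤order : ∀ q → b p i ℕ.+ β p ℕ.∸ β q ℕ.≤ order q
        level≤order q = begin
          b p i ℕ.+ β p ℕ.∸ β q    ≤⟨ ℕ.∸-monoˡ-≤ (β q) (ℕ.+-monoˡ-≤ (β p) b≤a) ⟩
          a ℕ.+ β p ℕ.∸ β q        ≡⟨ cong (ℕ._∸ β q) (≡.trans (sym (ℕ.m+n∸n≡m _ r)) (cong (ℕ._∸ r) (rearrange a (β p) r))) ⟩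
          t ℕ.∸ r ℕ.∸ β q          ≡⟨ ℕ.∸-+-assoc t r (β q) ⟩
          t ℕ.∸ (r ℕ.+ β q)        ≡⟨ cong (t ℕ.∸_) (ℕ.+-comm r (β q)) ⟩
          t ℕ.∸ (β q ℕ.+ r)        ≡⟨ ℕ.∸-+-assoc t (β q) r ⟨
          order q                  ∎
          where
          open ℕ.≤-Reasoning
          rearrange : ∀ a b r → a ℕ.+ b ℕ.+ r ≡ a ℕ.+ r ℕ.+ b
          rearrange = solve-∀
        enough : D ℕ.≤ sum μ
        enough = ℕ.≤-trans (heavy p β≤s i) (sum-mono (λ q → at-mono (κ q i) (κ p i) (level≤order q)))

      advance : ∀ t → t ℕ.< s ℕ.+ D → VanishesAt t → VanishesAt (suc t)
      advance t t< van p us us< with β p ℕ.≤? t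
      ... | no ≰ = contradiction us< (subst (λ o → ¬ (length us ℕ.< o)) (sym (ℕ.m≤n⇒m∸n≡0 (ℕ.≰⇒> ≰))) λ ())
      ... | yes β≤t with ℕ.m<1+n⇒m<n∨m≡n (subst (length us ℕ.<_) (ℕ.+-∸-assoc 1 β≤t) us<)
      ...   | inj₁ us<r = van p us us<r
      ...   | inj₂ us≡r = subst (λ ws → F ws (x p) ≡ 0ℝ) (++-identityʳ us)
                (vanishes-by-spanning poly (v p) (spanning p) (x p) (t ℕ.∸ β p) basis-words us [] (≡.trans (ℕ.+-identityʳ _) us≡r))
        where
        -- A joint above the gap cannot be active before time `s + D`, so this one lies below it.
        β≤s : β p ℕ.≤ s
        β≤s with separated p
        ... | inj₁ ≤s = ≤s
        ... | inj₂ ≥s = contradiction (ℕ.≤-trans ≥s β≤t) (ℕ.<⇒≱ t<)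
        basis-words : ∀ w → length w ≡ t ℕ.∸ β p → F (map (v p) w) (x p) ≡ 0ℝ
        basis-words w w≡r with Fin.all? (λ i → occ i w ℕ.<? b p i)
        ... | yes small with words-complete (suc n) (b p) w small
        ...   | w′ , w′∈ , w↭w′ = ≡.trans (symmetric poly (map⁺ (v p) w↭w′) (x p)) (conditions p w′ w′∈)
        basis-words w w≡r | no large with Fin.¬∀⟶∃¬ (suc n) _ (λ i → occ i w ℕ.<? b p i) large
        ... | i , ≮ = ≡.trans (symmetric poly (map⁺ (v p) (delete-↭ i w)) (x p))
              (≡.trans (cong (λ us → F us (x p)) (≡.trans (map-++ (v p) (delete i w) _)
                (cong (map (v p) (delete i w) ++_) (map-replicate (v p) (occ i w) i))))
              (along-line t van p β≤s i (map (v p) (delete i w)) (occ i w) total (ℕ.≮⇒≥ ≮)))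
          where
          open ≡-Reasoning
          total : occ i w ℕ.+ length (map (v p) (delete i w)) ℕ.+ β p ≡ t
          total = begin
            occ i w ℕ.+ length (map (v p) (delete i w)) ℕ.+ β p
              ≡⟨ cong (ℕ._+ β p) (≡.trans (cong (occ i w ℕ.+_) (length-map (v p) (delete i w))) (ℕ.+-comm (occ i w) _)) ⟩
            length (delete i w) ℕ.+ occ i w ℕ.+ β p
              ≡⟨ cong (λ c → length (delete i w) ℕ.+ c ℕ.+ β p) (length-replicate (occ i w)) ⟨
            length (delete i w) ℕ.+ length (replicate (occ i w) i) ℕ.+ β p
              ≡⟨ cong (ℕ._+ β p) (≡.trans (sym (length-++ (delete i w))) (sym (↭-length (delete-↭ i w)))) ⟩
            length w ℕ.+ β p        ≡⟨ cong (ℕ._+ β p) w≡r ⟩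
            t ℕ.∸ β p ℕ.+ β p       ≡⟨ ℕ.m∸n+n≡m β≤t ⟩
            t                       ∎

      vanishes : ∀ t → t ℕ.≤ s ℕ.+ D → VanishesAt t
      vanishes zero _ p us us< = contradiction us< (subst (λ o → ¬ (length us ℕ.< o)) (sym (ℕ.0∸n≡0 (β p))) λ ())
      vanishes (suc t) t< = advance t t< (vanishes t (ℕ.<⇒≤ t<))

      -- At time `s + D` the order at `p` is at least `D`, so this one zero exceeds the degree on
      -- the line from `x p` to `y`, where `y` has parameter 1.
      vanishes-everywhere : (∃ λ p → β p ℕ.≤ s) → ∀ y → F [] y ≡ 0ℝ
      vanishes-everywhere (p , β≤s) y = ≡.trans
        (ext poly [] (λ k → sym (≡.trans (cong (x p k +_) (*-identityˡ _)) (y+[x-y]≡x (y k) (x p k)))))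
        (roots-exceed-degree D (degree poly [] (x p) w) {1} (λ _ → 0ℝ) (λ _ → D)
          (λ { zero zero 0≢0 _ _ → contradiction refl 0≢0 }) root (ℕ.m≤m+n D 0) 0 1ℝ)
        where
        w : Vec (suc n)
        w k = y k - x p k
        root : ∀ (i : Fin 1) a → a ℕ.< D → along F [] (x p) w a 0ℝ ≡ 0ℝ
        root _ a a<D = ≡.trans (ext poly (replicate a w) (λ k → x+0≡x (≡.trans (*-comm 0ℝ _) (zeroʳ _))))
          (vanishes (s ℕ.+ D) ℕ.≤-refl p (replicate a w) (subst (ℕ._< s ℕ.+ D ℕ.∸ β p) (sym (length-replicate a))
            (ℕ.<-≤-trans a<D (ℕ.≤-trans (ℕ.≤-reflexive (sym (ℕ.m+n∸m≡n (β p) D))) (ℕ.∸-monoˡ-≤ (β p) (ℕ.+-monoˡ-≤ D β≤s))))))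

    module _ (E : ℕ) where
      open Lagrange (suc n) E
      open Balance κ (suc (suc n ℕ.* E)) (E ℕ.^ suc n) using (Covering)

      -- With too few conditions, some nontrivial combination of the basis satisfies them all and
      -- hence vanishes. Its value at a node isolates a single coefficient, one that was chosen
      -- nonzero.
      covering : Covering
      covering β s b separated low heavy = ℕ.≮⇒≥ too-few
        where
        row : Fin m → List (Fin (suc n)) → Fin (E ℕ.^ suc n) → ℝ
        row p w δ = basis δ (map (v p) w) (x p)
        rowsAt : Fin m → List (Fin (E ℕ.^ suc n) → ℝ)
        rowsAt p = map (row p) (words (suc n) (b p))
        rows = concatFin rowsAt
        length-rows : length rows ≡ sum (λ p → ∏ (b p))
        length-rows = ≡.trans (length-concatFin rowsAt)
          (sum-cong-≗ (λ p → ≡.trans (length-map (row p) (words (suc n) (b p))) (length-words (suc n) (b p))))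
        too-few : ¬ (sum (λ p → ∏ (b p)) ℕ.< E ℕ.^ suc n)
        too-few few with kernel-nontrivial _ rows length-rows few
        ... | a , (δ , aδ≢0) , kernel = basis-own δ (*-cancel-0 aδ≢0 (≡.trans
              (sym (∑-only (λ ε → a ε * basis ε [] (node δ)) δ (λ ε ε≢δ → x*0≡0 (basis-other ε δ ε≢δ))))
              (vanishes-everywhere low (node δ))))
          where
          open Vanishing β s b separated heavy
            (combination-polynomial a basis basis-polynomial)
            (λ p w w∈ → All.lookup kernel (∈-concatFin rowsAt p (∈-map⁺ (row p) w∈)))
            using (vanishes-everywhere)

-- From the counting bound to multijoints

open import Data.Nat using (ℕ; zero; suc; z≤n; s≤s; z<s; _≤_; _<_; _^_; _*_; _+_; _∸_)
open import Data.Nat.Properties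
open import Data.Fin using (Fin; zero; suc)
open import Data.Product using (Σ; ∃; _,_; proj₁; proj₂)
open import Data.List using (List; []; _∷_; length; lookup)
open import Data.List.Relation.Unary.All as All using (All; []; _∷_)
open import Data.List.Relation.Unary.AllPairs using (AllPairs; []; _∷_)
open import Data.List.Relation.Unary.Any using (index)
open import Data.List.Relation.Unary.Any.Properties using (lookup-index)
open import Data.List.Membership.Propositional.Properties using (∈-lookup)
open import Data.Vec.Functional using (foldr)
open import Relation.Nullary using (contradiction)
open import Relation.Binary.PropositionalEquality hiding ([_])
open import Function using (_∘_)
open import Data.Nat.Tactic.RingSolver using (solve-∀)
open Handicaps

AllPairs-lookup : ∀ {A : Set} {_~_ : A → A → Set} → (∀ {x y} → x ~ y → y ~ x) →
  ∀ {xs} → AllPairs _~_ xs → ∀ i j → i ≢ j → lookup xs i ~ lookup xs j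
AllPairs-lookup symm (_ ∷ _) zero zero i≢j = contradiction refl i≢j
AllPairs-lookup symm (all ∷ _) zero (suc j) _ = All.lookup all (∈-lookup j)
AllPairs-lookup symm (all ∷ _) (suc i) zero _ = symm (All.lookup all (∈-lookup i))
AllPairs-lookup symm (_ ∷ pairs) (suc i) (suc j) i≢j = AllPairs-lookup symm pairs i j (i≢j ∘ cong suc)

^-distribʳ-* : ∀ k a b → (a * b) ^ k ≡ a ^ k * b ^ k
^-distribʳ-* zero a b = refl
^-distribʳ-* (suc k) a b = trans (cong (a * b *_) (^-distribʳ-* k a b)) ([m*n]*[o*p]≡[m*o]*[n*p] a b (a ^ k) (b ^ k))

-- The degree bound `suc (suc n * m)` is at most twice `suc n * m`. Together with the 3 from
-- rounding and the `suc n` from the union bound this gives the constant.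
cancel-bound : ∀ n m P → 0 < m →
  m ^ suc n * m ^ suc n ≤ m * ((suc n * (3 * suc (suc n * m))) ^ suc n * P) →
  m ^ n ≤ (6 * (suc n * suc n)) ^ suc n * P
cancel-bound n m@(suc _) P 0<m h = *-cancelʳ-≤ (m ^ n) _ (m * m ^ suc n) (begin
  m ^ n * (m * m ^ suc n)                      ≡⟨ swap (m ^ n) m (m ^ suc n) ⟩
  m ^ suc n * m ^ suc n                        ≤⟨ h ⟩
  m * ((suc n * (3 * suc (suc n * m))) ^ suc n * P)
    ≤⟨ *-monoʳ-≤ m (*-monoˡ-≤ P (^-monoˡ-≤ (suc n) (*-monoʳ-≤ (suc n) (*-monoʳ-≤ 3 degree≤)))) ⟩
  m * ((suc n * (3 * (suc n * m + suc n * m))) ^ suc n * P)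
    ≡⟨ cong (λ b → m * (b ^ suc n * P)) (collect (suc n) m) ⟩
  m * ((6 * (suc n * suc n) * m) ^ suc n * P)
    ≡⟨ cong (λ b → m * (b * P)) (^-distribʳ-* (suc n) (6 * (suc n * suc n)) m) ⟩
  m * ((6 * (suc n * suc n)) ^ suc n * m ^ suc n * P)
    ≡⟨ regroup m ((6 * (suc n * suc n)) ^ suc n) (m ^ suc n) P ⟩
  (6 * (suc n * suc n)) ^ suc n * P * (m * m ^ suc n) ∎)
  where
  open ≤-Reasoning
  instance _ = m*n≢0 m (m ^ suc n) {{Data.Nat.nonZero}} {{m^n≢0 m (suc n)}}
  degree≤ : suc (suc n * m) ≤ suc n * m + suc n * m
  degree≤ = +-monoˡ-≤ (suc n * m) (*-mono-≤ {1} {suc n} {1} {m} z<s 0<m)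
  swap : ∀ a b c → a * (b * c) ≡ b * a * c
  swap = solve-∀
  collect : ∀ s m → s * (3 * (s * m + s * m)) ≡ 6 * (s * s) * m
  collect = solve-∀
  regroup : ∀ m c p P → m * (c * p * P) ≡ c * P * (m * p)
  regroup = solve-∀

multijoints : ∀ n (R : RealNumbers) → let open Geometry R in
  (𝔏 : Fin (suc n) → List (Line (suc n))) (xs : List (Vec (suc n))) →
  AllPairs _≢ᵖ_ xs → All (IsMultijoint 𝔏) xs → 0 < length xs →
  length xs ^ n ≤ (6 * (suc n * suc n)) ^ suc n * foldr _*_ 1 (λ i → length (𝔏 i))
multijoints n R 𝔏 xs pairs all 0<m = cancel-bound n m _ 0<m
  (Balance.multijoint-bound κ (suc (suc n * m)) (m ^ suc n)
    (covering κ (lookup xs) v distinct collinear (λ p → proj₂ (proj₂ (proj₂ (joint p)))) m)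
    (m^n>0 m {{Data.Nat.>-nonZero 0<m}} (suc n)) 0<m (≤-trans (m≤m+n m (n * m)) (n≤1+n _)))
  where
  open RealNumbers R using (ℝ)
  open Geometry R
  open Field R using (_-_; y+[x-y]≡x; commutativeRing)
  open Joints R using (covering)
  open import Algebra.Bundles using (CommutativeRing)
  open import Algebra.Solver.Ring.NaturalCoefficients.Default (CommutativeRing.commutativeSemiring commutativeRing)
    using (solve; _:=_; _:+_; _:*_)
  module ℝ = RealNumbers R
  m = length xs
  joint : ∀ p → IsMultijoint 𝔏 (lookup xs p)
  joint p = All.lookup all (∈-lookup p)
  l : Fin m → Fin (suc n) → Line (suc n)
  l p = proj₁ (joint p)
  v : Fin m → Fin (suc n) → Vec (suc n)
  v p i = dir (l p i)
  κ : Fin m → (i : Fin (suc n)) → Fin (length (𝔏 i))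
  κ p i = index (proj₁ (proj₂ (joint p)) i)
  same-line : ∀ p q i → κ q i ≡ κ p i → l q i ≡ l p i
  same-line p q i eq = trans (lookup-index (proj₁ (proj₂ (joint q)) i))
    (trans (cong (lookup (𝔏 i)) eq) (sym (lookup-index (proj₁ (proj₂ (joint p)) i))))
  distinct : ∀ p q → p ≢ q → lookup xs p ≢ᵖ lookup xs q
  distinct = AllPairs-lookup (λ x≢y y≡x → x≢y (λ k → sym (y≡x k))) pairs
  collinear : ∀ p q i → κ q i ≡ κ p i → ∃ λ τ → ∀ k → lookup xs q k ≡ lookup xs p k ℝ.+ τ ℝ.* v p i k
  collinear p q i eq with proj₁ (proj₂ (proj₂ (joint p))) i
    | subst (lookup xs q ∈ᴸ_) (same-line p q i eq) (proj₁ (proj₂ (proj₂ (joint q))) i)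
  ... | t , xp≡ | u , xq≡ = u - t , λ k → begin
    lookup xs q k                                                ≡⟨ xq≡ k ⟩
    base (l p i) k ℝ.+ u ℝ.* v p i k                             ≡⟨ cong (λ z → base (l p i) k ℝ.+ z ℝ.* v p i k) (y+[x-y]≡x u t) ⟨
    base (l p i) k ℝ.+ (t ℝ.+ (u - t)) ℝ.* v p i k
      ≡⟨ solve 4 (λ b t w d → b :+ (t :+ w) :* d := b :+ t :* d :+ w :* d) refl (base (l p i) k) t (u - t) (v p i k) ⟩
    base (l p i) k ℝ.+ t ℝ.* v p i k ℝ.+ (u - t) ℝ.* v p i k     ≡⟨ cong (ℝ._+ (u - t) ℝ.* v p i k) (xp≡ k) ⟨
    lookup xs p k ℝ.+ (u - t) ℝ.* v p i k                        ∎
    where open ≡-Reasoning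

theorem2 : (n : ℕ) → 2 ≤ n →
    Σ ℕ λ c →
    (R : RealNumbers) → let open Geometry R in
    (𝔏 : Fin n → List (Line n)) →
    (xs : List (Vec n)) → AllPairs _≢ᵖ_ xs → All (IsMultijoint 𝔏) xs →
    length xs ^ (n ∸ 1) ≤ c * foldr _*_ 1 (λ i → length (𝔏 i))
theorem2 (suc (suc n)) (s≤s (s≤s z≤n)) = (6 * (suc (suc n) * suc (suc n))) ^ suc (suc n) ,
  λ where
    -- The exponent is positive because the dimension is at least two, so the left side is zero.
    R 𝔏 [] _ _ → z≤n
    R 𝔏 (x ∷ xs) pairs all → multijoints (suc n) R 𝔏 (x ∷ xs) pairs all z<s
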